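{- For all $k\geq4$ and $n\geq3$, the DCell $D_{k,n}$ is super-$\lambda_3$: every minimum $3$-restricted edge-cut $F$ of $D_{k,n}$ is such that $D_{k,n}-F$ has a component that is a connected subgraph on exactly three vertices.
   Context: DCell $D_{k,n}$ ($n\geq 2$, $k\geq 0$) is defined recursively. $D_{0,n}$ is the complete graph $K_n$ on vertices $0,1,\dots,n-1$. Let $t_{k,n}=|V(D_{k,n})|$. For $k\geq1$, $D_{k,n}$ is built from $t_{k-1,n}+1$ disjoint copies $D^0_{k-1,n},\dots,D^{t_{k-1,n}}_{k-1,n}$ of $D_{k-1,n}$; a vertex of copy $D^i_{k-1,n}$ is labeled $(i,a_{k-1},\dots,a_0)$, where $(a_{k-1},\dots,a_0)$ is its label in $D_{k-1,n}$, and its index within the copy is $uid_{k-1}=a_0+\sum_{l=1}^{k-1}a_l t_{l-1,n}$. For each pair $a<b$ of copy indices, one edge joins the vertex of $D^a_{k-1,n}$ with $uid_{k-1}=b-1$ to the vertex of $D^b_{k-1,n}$ with $uid_{k-1}=a$. An edge set $F$ is an $m$-restricted edge-cut of $G$ if $G-F$ is disconnected and every component has at least $m$ vertices; $G$ is super-$\lambda_m$ if every minimum $m$-restricted edge-cut isolates a connected subgraph on exactly $m$ vertices. -}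

module Defs where

open import Data.Nat using (ℕ; zero; suc; _+_; _*_; _∸_; _<_; _≤_)
open import Data.Fin using (Fin; toℕ)
open import Data.Product using (Σ; _×_; _,_; ∃)
open import Data.Sum using (_⊎_)
open import Data.List using (List; length)
open import Data.List.Membership.Propositional using (_∈_)
open import Data.List.Relation.Unary.All using (All)
open import Data.List.Relation.Unary.AllPairs using (AllPairs)
open import Data.List.Relation.Unary.Unique.Propositional using (Unique)
open import Relation.Binary.PropositionalEquality using (_≡_; _≢_)
open import Relation.Nullary using (¬_)

-- t k n = |V(D_{k,n})|
t : ℕ → ℕ → ℕ
t zero    n = n
t (suc k) n = suc (t k n) * t k n

-- Vertices of D_{k,n}, as labels:
--   D_{0,n}: a_0 ∈ {0..n-1};
--   D_{k+1,n}: (copy index i ∈ {0..t_{k,n}}, label in D_{k,n}).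
Vertex : ℕ → ℕ → Set
Vertex zero    n = Fin n
Vertex (suc k) n = Fin (suc (t k n)) × Vertex k n

uid : ∀ k n → Vertex k n → ℕ
uid zero    n a       = toℕ a
uid (suc k) n (i , v) = toℕ i * t k n + uid k n v

Adj : ∀ k n → Vertex k n → Vertex k n → Set
Adj zero    n x y = x ≢ y
Adj (suc k) n (i , u) (j , v) =
    (i ≡ j × Adj k n u v)
  ⊎ (toℕ i < toℕ j × uid k n u ≡ toℕ j ∸ 1 × uid k n v ≡ toℕ i)
  ⊎ (toℕ j < toℕ i × uid k n v ≡ toℕ i ∸ 1 × uid k n u ≡ toℕ j)

module _ (k n : ℕ) where

  V : Set
  V = Vertex k n

  SameEdge : V × V → V × V → Set
  SameEdge (a , b) (c , d) = (a ≡ c × b ≡ d) ⊎ (a ≡ d × b ≡ c)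

  IsEdgeSet : List (V × V) → Set
  IsEdgeSet F = All (λ { (a , b) → Adj k n a b }) F
              × AllPairs (λ e e′ → ¬ SameEdge e e′) F

  Removed : List (V × V) → V → V → Set
  Removed F a b = ((a , b) ∈ F) ⊎ ((b , a) ∈ F)

  AdjMinus : List (V × V) → V → V → Set
  AdjMinus F a b = Adj k n a b × ¬ Removed F a b

  data Reach (F : List (V × V)) (u : V) : V → Set where
    here : Reach F u u
    step : ∀ {v w} → Reach F u v → AdjMinus F v w → Reach F u w

  Disconnected : List (V × V) → Set
  Disconnected F = Σ V λ u → Σ V λ v → ¬ Reach F u v

  CompAtLeast : ℕ → List (V × V) → V → Set
  CompAtLeast m F u = Σ (List V) λ L → length L ≡ m × Unique L × All (Reach F u) L

  CompExactly : ℕ → List (V × V) → V → Set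
  CompExactly m F u = Σ (List V) λ L → length L ≡ m × Unique L × All (Reach F u) L
                      × (∀ v → Reach F u v → v ∈ L)

  RestrictedCut : ℕ → List (V × V) → Set
  RestrictedCut m F = IsEdgeSet F × Disconnected F × (∀ u → CompAtLeast m F u)

  MinRestrictedCut : ℕ → List (V × V) → Set
  MinRestrictedCut m F = RestrictedCut m F
                       × (∀ F′ → RestrictedCut m F′ → length F ≤ length F′)

  SuperLambda : ℕ → Set
  SuperLambda m = ∀ F → MinRestrictedCut m F → Σ V λ u → CompExactly m F u

{-# OPTIONS --safe #-}
module Submission where

-- Let d = n + k - 1 be the degree. The boundary of a triangle in some K_n is a 3-restricted edge-cut with
-- 3d - 6 edges. So it suffices that a set X with at least four vertices inside and outside has at least
-- 3d - 5 boundary edges: if no component of D_k - F has exactly three vertices, apply this to one of them.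
--
-- If X meets only one copy of D_{k-1}, or only two of them (which share a single edge), then nearly every
-- vertex of X contributes its cross edge to the boundary. Hence induct on k for the functional cut X + c|X|:
-- moving one level down turns c into c + 1 and preserves k + c, and at level 0 the functional is p(q + c)
-- for p vertices inside and q outside. If X meets three copies and fills none of them, each contributes at
-- least d - 1 edges, by the edge-connectivity of D_{k-1}. If X meets every copy, pass to the complement. If
-- X fills one copy and misses another, then the boundary has at least t_{k-1} edges.

open import Defs
open import Data.Bool using (Bool; true; false; T; T?; not; _∧_; if_then_else_)
open import Data.Bool.Properties using (not-involutive)
open import Data.Fin as Fin using (Fin; toℕ; punchIn; punchOut; combine; remQuot; fromℕ<)
open import Data.Fin.Properties as Fin
  using (punchInᵢ≢i; punchIn-injective; punchIn-punchOut; toℕ-combine; remQuot-combine; combine-remQuot;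
         toℕ-injective; toℕ<n; toℕ-fromℕ<)
open import Data.List using (List; []; _∷_; _++_; map; filter; length; allFin; upTo; cartesianProduct)
open import Data.List.Properties using (length-map; length-++; map-∘; map-cong; length-tabulate)
open import Data.List.Membership.Propositional using (_∈_; find; lose)
import Data.List.Membership.DecPropositional as DecMembership
open import Data.List.Membership.Propositional.Properties
  using (∈-∃++; ∈-++⁺ˡ; ∈-++⁺ʳ; ∈-++⁻; ∈-map⁺; ∈-map⁻;
         ∈-filter⁺; ∈-filter⁻; ∈-cartesianProduct⁺; ∈-cartesianProduct⁻; ∈-allFin; ∈-upTo⁺)
open import Data.List.Relation.Binary.Subset.Propositional using (_⊆_)
open import Data.List.Relation.Unary.All as All using (All; []; _∷_)
import Data.List.Relation.Unary.All.Properties as All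
open import Data.List.Relation.Unary.AllPairs using (AllPairs; []; _∷_)
open import Data.List.Relation.Unary.Any as Any using (here; there)
open import Data.List.Relation.Unary.Unique.Propositional using (Unique)
import Data.List.Relation.Unary.Unique.Propositional.Properties as Unique
open import Data.Nat using (ℕ; zero; suc; _+_; _*_; _∸_; _≤_; _<_; z≤n; s≤s; _≤?_; _<?_)
open import Data.Nat.Properties
open import Data.Nat.ListAction using (sum)
open import Data.Nat.Tactic.RingSolver using (solve-∀)
open import Data.Product using (∃; _×_; _,_; proj₁; proj₂; swap)
open import Data.Product.Properties using (≡-dec)
open import Data.Sum as Sum using (_⊎_; inj₁; inj₂)
open import Function using (_∘_; id; case_of_)
open import Level using (Level)
open import Relation.Binary.Definitions using (DecidableEquality)
open import Relation.Binary.PropositionalEquality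
  using (_≡_; _≢_; refl; sym; trans; cong; cong₂; subst; subst₂; module ≡-Reasoning)
open import Relation.Nullary using (¬_; Dec; yes; no; does; contradiction)
open import Relation.Nullary.Decidable using (¬?; _×-dec_; _⊎-dec_; dec-true; dec-false)
open import Relation.Unary using (Pred; Decidable)
open import Algebra.Properties.CommutativeSemigroup +-commutativeSemigroup using (interchange; x∙yz≈y∙xz)

-- Finite sums and counting over lists.

private variable
  a : Level
  A B : Set a

does-true : ∀ {P : Set a} (P? : Dec P) → does P? ≡ true → P
does-true (yes p) _ = p

⟦_⟧ : Bool → ℕ
⟦ b ⟧ = if b then 1 else 0

∑ : List A → (A → ℕ) → ℕ
∑ xs f = sum (map f xs)

∑-mono : ∀ (xs : List A) {f g : A → ℕ} → (∀ x → f x ≤ g x) → ∑ xs f ≤ ∑ xs g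
∑-mono []       f≤g = z≤n
∑-mono (x ∷ xs) f≤g = +-mono-≤ (f≤g x) (∑-mono xs f≤g)

∑-cong : ∀ (xs : List A) {f g : A → ℕ} → (∀ x → f x ≡ g x) → ∑ xs f ≡ ∑ xs g
∑-cong xs f≡g = cong sum (map-cong f≡g xs)

∑-+ : ∀ (xs : List A) (f g : A → ℕ) → ∑ xs (λ x → f x + g x) ≡ ∑ xs f + ∑ xs g
∑-+ []       f g = refl
∑-+ (x ∷ xs) f g = trans (cong (f x + g x +_) (∑-+ xs f g)) (interchange (f x) (g x) _ _)

∑-* : ∀ (xs : List A) c (f : A → ℕ) → ∑ xs (λ x → c * f x) ≡ c * ∑ xs f
∑-* []       c f = sym (*-zeroʳ c)
∑-* (x ∷ xs) c f = trans (cong (c * f x +_) (∑-* xs c f)) (sym (*-distribˡ-+ c (f x) _))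

∑-0 : ∀ (xs : List A) {f : A → ℕ} → (∀ x → f x ≡ 0) → ∑ xs f ≡ 0
∑-0 []       f≡0 = refl
∑-0 (x ∷ xs) f≡0 = cong₂ _+_ (f≡0 x) (∑-0 xs f≡0)

∑-1 : ∀ (xs : List A) → ∑ xs (λ _ → 1) ≡ length xs
∑-1 []       = refl
∑-1 (x ∷ xs) = cong suc (∑-1 xs)

∑-++ : ∀ (xs ys : List A) (f : A → ℕ) → ∑ (xs ++ ys) f ≡ ∑ xs f + ∑ ys f
∑-++ []       ys f = refl
∑-++ (x ∷ xs) ys f = trans (cong (f x +_) (∑-++ xs ys f)) (sym (+-assoc (f x) _ _))

length-cartesianProduct : ∀ (xs : List A) (ys : List B) → length (cartesianProduct xs ys) ≡ length xs * length ys
length-cartesianProduct []       ys = refl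
length-cartesianProduct (x ∷ xs) ys = trans (length-++ (map (x ,_) ys))
  (cong₂ _+_ (length-map (x ,_) ys) (length-cartesianProduct xs ys))

∑-map : ∀ (h : B → A) (xs : List B) (f : A → ℕ) → ∑ (map h xs) f ≡ ∑ xs (f ∘ h)
∑-map h xs f = cong sum (sym (map-∘ xs))

∑-× : ∀ (xs : List A) (ys : List B) (f : A × B → ℕ) →
      ∑ (cartesianProduct xs ys) f ≡ ∑ xs (λ x → ∑ ys (λ y → f (x , y)))
∑-× []       ys f = refl
∑-× (x ∷ xs) ys f = trans (∑-++ (map (x ,_) ys) _ f) (cong₂ _+_ (∑-map (x ,_) ys f) (∑-× xs ys f))

-- Each head of `xs` is cut out of `ys`; uniqueness keeps the rest of `xs` inside what remains.
-- Every later count by an injection reduces to this.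
∑-⊆ : ∀ {xs ys : List A} (f : A → ℕ) → Unique xs → xs ⊆ ys → ∑ xs f ≤ ∑ ys f
∑-⊆ {xs = []}     f []         xs⊆ys = z≤n
∑-⊆ {xs = x ∷ xs} f (x∉xs ∷ u) xs⊆ys with ∈-∃++ (xs⊆ys (here refl))
... | as , bs , refl = begin
  f x + ∑ xs f               ≤⟨ +-monoʳ-≤ (f x) (∑-⊆ f u xs⊆as++bs) ⟩
  f x + ∑ (as ++ bs) f       ≡⟨ cong (f x +_) (∑-++ as bs f) ⟩
  f x + (∑ as f + ∑ bs f)    ≡⟨ x∙yz≈y∙xz (f x) (∑ as f) (∑ bs f) ⟩
  ∑ as f + (f x + ∑ bs f)    ≡⟨ ∑-++ as (x ∷ bs) f ⟨
  ∑ (as ++ x ∷ bs) f         ∎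
  where
  open ≤-Reasoning
  xs⊆as++bs : xs ⊆ as ++ bs
  xs⊆as++bs y∈xs with ∈-++⁻ as (xs⊆ys (there y∈xs))
  ... | inj₁ y∈as         = ∈-++⁺ˡ y∈as
  ... | inj₂ (here refl)  = contradiction refl (All.lookup x∉xs y∈xs)
  ... | inj₂ (there y∈bs) = ∈-++⁺ʳ as y∈bs

length-⊆ : ∀ {xs ys : List A} → Unique xs → xs ⊆ ys → length xs ≤ length ys
length-⊆ {xs = xs} {ys} u xs⊆ys = subst₂ _≤_ (∑-1 xs) (∑-1 ys) (∑-⊆ (λ _ → 1) u xs⊆ys)

∑-filter : ∀ {p} {P : Pred A p} (P? : Decidable P) xs {f : A → ℕ} →
           (∀ x → ¬ P x → f x ≡ 0) → ∑ (filter P? xs) f ≡ ∑ xs f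
∑-filter P? []       f≡0 = refl
∑-filter P? (x ∷ xs) {f} f≡0 with P? x
... | yes _  = cong (f x +_) (∑-filter P? xs f≡0)
... | no ¬px = trans (∑-filter P? xs f≡0) (sym (cong (_+ ∑ xs f) (f≡0 x ¬px)))

length-filter : ∀ {p} {P : Pred A p} (P? : Decidable P) xs →
                length (filter P? xs) ≡ ∑ xs (λ x → ⟦ does (P? x) ⟧)
length-filter P? []       = refl
length-filter P? (x ∷ xs) with P? x
... | yes _ = cong suc (length-filter P? xs)
... | no _  = length-filter P? xs

∑-member : ∀ {xs : List A} {x} (f : A → ℕ) → x ∈ xs → f x ≤ ∑ xs f
∑-member {x = x} f x∈xs = ≤-trans (m≤m+n (f x) 0) (∑-⊆ f ([] ∷ []) (λ { (here refl) → x∈xs }))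

∑-single : ∀ {m} (f : Fin m → ℕ) j → (∀ i → i ≢ j → f i ≡ 0) → ∑ (allFin m) f ≤ f j
∑-single {m} f j f≡0 = begin
  ∑ (allFin m) f                     ≡⟨ ∑-filter (Fin._≟ j) (allFin m) f≡0 ⟨
  ∑ (filter (Fin._≟ j) (allFin m)) f ≤⟨ ∑-⊆ f (Unique.filter⁺ (Fin._≟ j) (Unique.allFin⁺ m)) ⊆[j] ⟩
  f j + 0                            ≡⟨ +-identityʳ (f j) ⟩
  f j                                ∎
  where
  open ≤-Reasoning
  ⊆[j] : filter (Fin._≟ j) (allFin m) ⊆ j ∷ []
  ⊆[j] p = here (proj₂ (∈-filter⁻ (Fin._≟ j) {xs = allFin m} p))

-- Numerical inequalities behind the case analysis.

-- This is `(p - j)(q - j) ≥ 0`, expanded without subtraction.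
product-bound : ∀ j {p q} → j ≤ p → j ≤ q → j * (p + q) ≤ p * q + j * j
product-bound j j≤p j≤q with m≤n⇒∃[o]m+o≡n j≤p | m≤n⇒∃[o]m+o≡n j≤q
... | a , refl | b , refl = ≤-trans (m≤m+n _ (a * b)) (≤-reflexive (identity j a b))
  where
  identity : ∀ j a b → j * (j + a + (j + b)) + a * b ≡ (j + a) * (j + b) + j * j
  identity = solve-∀

-- This is `(p - 3)(q - 3) ≥ 1`. Having four rather than three vertices on each side improves the
-- constant 9 to 8, and the whole theorem rests on that one edge.
product-bound₄ : ∀ {p q} → 4 ≤ p → 4 ≤ q → 3 * (p + q) ≤ p * q + 8
product-bound₄ 4≤p 4≤q with m≤n⇒∃[o]m+o≡n 4≤p | m≤n⇒∃[o]m+o≡n 4≤q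
... | a , refl | b , refl = ≤-trans (m≤m+n _ (a + b + a * b)) (≤-reflexive (identity a b))
  where
  identity : ∀ a b → 3 * (4 + a + (4 + b)) + (a + b + a * b) ≡ (4 + a) * (4 + b) + 8
  identity = solve-∀

-- Two occupied copies of weights `a` and `b` in a set of weight `w`; the 2 accounts for the shared
-- edge, seen from both ends.
pair-bound₂ : ∀ {x a b w} → x ≤ a + 1 → x ≤ b + 1 → a + b ≤ w + 2 → 2 * x ≤ w + 4
pair-bound₂ {x} {a} {b} {w} p q r = begin
  2 * x             ≡⟨ cong (x +_) (+-identityʳ x) ⟩
  x + x             ≤⟨ +-mono-≤ p q ⟩
  a + 1 + (b + 1)   ≡⟨ interchange a 1 b 1 ⟩
  a + b + 2         ≤⟨ +-monoˡ-≤ 2 r ⟩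
  w + 2 + 2         ≡⟨ +-assoc w 2 2 ⟩
  w + 4             ∎
  where open ≤-Reasoning

pair-bound₄ : ∀ {x a b w} → x ≤ a + 1 → 2 * x ≤ b + 4 → a + b ≤ w + 2 → 3 * x ≤ w + 8
pair-bound₄ {x} {a} {b} {w} p q r = begin
  x + 2 * x         ≤⟨ +-mono-≤ p q ⟩
  a + 1 + (b + 4)   ≡⟨ interchange a 1 b 4 ⟩
  a + b + 5         ≤⟨ +-monoˡ-≤ 5 r ⟩
  w + 2 + 5         ≡⟨ +-assoc w 2 5 ⟩
  w + 7             ≤⟨ +-monoʳ-≤ w (n≤1+n 7) ⟩
  w + 8             ∎
  where open ≤-Reasoning

-- Three occupied copies: `y` belongs to a copy and `suc y` to the graph one level up, so each copy
-- loses 1 in its own bound and 1 in the change of level.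
triple-bound : ∀ {y a b c w} → y ≤ a + 1 → y ≤ b + 1 → y ≤ c + 1 → a + b + c ≤ w → 3 * suc y ≤ w + 6
triple-bound {y} {a} {b} {c} {w} p q r le = begin
  3 * suc y                         ≡⟨ lhs y ⟩
  y + y + y + 3                     ≤⟨ +-monoˡ-≤ 3 (+-mono-≤ (+-mono-≤ p q) r) ⟩
  a + 1 + (b + 1) + (c + 1) + 3     ≡⟨ rhs a b c ⟩
  a + b + c + 6                     ≤⟨ +-monoˡ-≤ 6 le ⟩
  w + 6                             ∎
  where
  open ≤-Reasoning
  lhs : ∀ y → 3 * suc y ≡ y + y + y + 3
  lhs = solve-∀
  rhs : ∀ a b c → a + 1 + (b + 1) + (c + 1) + 3 ≡ a + b + c + 6
  rhs = solve-∀

triple⇒double : ∀ {x w} → 3 ≤ x → 3 * x ≤ w + 6 → 2 * x ≤ w + 4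
triple⇒double {x} {w} 3≤x le = +-cancelˡ-≤ 3 _ _ (begin
  3 + 2 * x    ≤⟨ +-monoˡ-≤ (2 * x) 3≤x ⟩
  3 * x        ≤⟨ le ⟩
  w + 6        ≤⟨ +-monoʳ-≤ w (n≤1+n 6) ⟩
  w + 7        ≡⟨ x∙yz≈y∙xz w 3 4 ⟩
  3 + (w + 4)  ∎)
  where open ≤-Reasoning

double⇒single : ∀ {x w} → 3 ≤ x → 2 * x ≤ w + 4 → x ≤ w + 1
double⇒single {x} {w} 3≤x le = +-cancelˡ-≤ 3 _ _ (begin
  3 + x        ≤⟨ +-monoˡ-≤ x 3≤x ⟩
  x + x        ≡⟨ cong (x +_) (+-identityʳ x) ⟨
  2 * x        ≤⟨ le ⟩
  w + 4        ≡⟨ x∙yz≈y∙xz w 3 1 ⟩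
  3 + (w + 1)  ∎)
  where open ≤-Reasoning

one-large : ∀ {p q} → 4 ≤ p + q → 2 ≤ p ⊎ 2 ≤ q
one-large {suc (suc p)}       _  = inj₁ (s≤s (s≤s z≤n))
one-large {zero}              le = inj₂ (≤-trans (s≤s (s≤s z≤n)) le)
one-large {suc zero}          le = inj₂ (≤-trans (s≤s (s≤s z≤n)) (≤-pred le))

-- Cross edges expressed by `punchIn`.

-- The cross edge of the vertex with index `x` in copy `i` goes to copy `x` if `x < i` and to copy
-- `x + 1` otherwise, that is, to `punchIn i x`. This form replaces the two cases of `Adj`.
toℕ-punchIn : ∀ {m} (i : Fin (suc m)) x → let j = punchIn i x in
  (toℕ i < toℕ j × toℕ x ≡ toℕ j ∸ 1) ⊎ (toℕ j < toℕ i × toℕ x ≡ toℕ j)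
toℕ-punchIn Fin.zero    x           = inj₁ (s≤s z≤n , refl)
toℕ-punchIn (Fin.suc i) Fin.zero    = inj₂ (s≤s z≤n , refl)
toℕ-punchIn (Fin.suc i) (Fin.suc x) with punchIn i x | toℕ-punchIn i x
... | Fin.suc j | inj₁ (i<j , x≡j) = inj₁ (s≤s i<j , cong suc x≡j)
... | j         | inj₂ (j<i , x≡j) = inj₂ (s≤s j<i , cong suc x≡j)

-- The value `j` has the preimage `punchOut i≢j`, and `toℕ-punchIn` shows that its index is that of
-- `x`.
punchIn-above : ∀ {m} {i j : Fin (suc m)} {x} → toℕ i < toℕ j → toℕ x ≡ toℕ j ∸ 1 → punchIn i x ≡ j
punchIn-above {i = i} {j} {x} i<j x≡j-1 = trans (cong (punchIn i) x≡y) (punchIn-punchOut i≢j)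
  where
  i≢j : i ≢ j
  i≢j i≡j = <-irrefl (cong toℕ i≡j) i<j
  x≡y : x ≡ punchOut i≢j
  x≡y with toℕ-punchIn i (punchOut i≢j)
  ... | p rewrite punchIn-punchOut i≢j with p
  ... | inj₁ (_ , y≡) = toℕ-injective (trans x≡j-1 (sym y≡))
  ... | inj₂ (j<i , _) = contradiction j<i (<-asym i<j)

punchIn-below : ∀ {m} {i j : Fin (suc m)} {x} → toℕ j < toℕ i → toℕ x ≡ toℕ j → punchIn i x ≡ j
punchIn-below {i = i} {j} {x} j<i x≡j = trans (cong (punchIn i) x≡y) (punchIn-punchOut i≢j)
  where
  i≢j : i ≢ j
  i≢j i≡j = <-irrefl (sym (cong toℕ i≡j)) j<i
  x≡y : x ≡ punchOut i≢j
  x≡y with toℕ-punchIn i (punchOut i≢j)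
  ... | p rewrite punchIn-punchOut i≢j with p
  ... | inj₁ (i<j , _) = contradiction i<j (<-asym j<i)
  ... | inj₂ (_ , y≡) = toℕ-injective (trans x≡j (sym y≡))

-- Vertex sets as Boolean functions.

co : (A → Bool) → A → Bool
co χ x = not (χ x)

-- Directed from inside to outside: of the two arcs of a boundary edge exactly one crosses, so a sum
-- over all arcs counts the edge once.
crosses : (A → Bool) → A × A → Bool
crosses χ (x , y) = χ x ∧ not (χ y)

copy : (A × B → Bool) → A → B → Bool
copy χ i v = χ (i , v)

-- Indices, cross edges and partners.

module _ {n : ℕ} where

  copies : ∀ k → List (Fin (suc (t k n)))
  copies k = allFin (suc (t k n))

  -- The `uid` as a bounded number, so that `punchIn` applies to it.
  index : ∀ k → Vertex k n → Fin (t k n)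
  index zero    a       = a
  index (suc k) (i , v) = combine i (index k v)

  vertexAt : ∀ k → Fin (t k n) → Vertex k n
  vertexAt zero    a = a
  vertexAt (suc k) x = let i , y = remQuot {suc (t k n)} (t k n) x in i , vertexAt k y

  toℕ-index : ∀ k v → toℕ (index k v) ≡ uid k n v
  toℕ-index zero    a       = refl
  toℕ-index (suc k) (i , v) =
    trans (toℕ-combine i (index k v)) (cong₂ _+_ (*-comm (t k n) (toℕ i)) (toℕ-index k v))

  index-vertexAt : ∀ k x → index k (vertexAt k x) ≡ x
  index-vertexAt zero    x = refl
  index-vertexAt (suc k) x = trans (cong (combine (proj₁ (remQuot {suc (t k n)} (t k n) x))) (index-vertexAt k _))
    (combine-remQuot {suc (t k n)} (t k n) x)

  vertexAt-index : ∀ k v → vertexAt k (index k v) ≡ v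
  vertexAt-index zero    v       = refl
  vertexAt-index (suc k) (i , v) = trans
    (cong (λ (j , y) → j , vertexAt k y) (remQuot-combine i (index k v)))
    (cong (i ,_) (vertexAt-index k v))

  index-injective : ∀ k {u v} → index k u ≡ index k v → u ≡ v
  index-injective k {u} {v} eq = trans (sym (vertexAt-index k u)) (trans (cong (vertexAt k) eq) (vertexAt-index k v))

  uid-injective : ∀ k {u v} → uid k n u ≡ uid k n v → u ≡ v
  uid-injective k {u} {v} eq =
    index-injective k (toℕ-injective (trans (toℕ-index k u) (trans eq (sym (toℕ-index k v)))))

  -- The copy in which the cross edge of the vertex v of copy i ends.
  target : ∀ k → Vertex (suc k) n → Fin (suc (t k n))
  target k (i , v) = punchIn i (index k v)

  -- The other end of the cross edge: the position in the target copy is the one whose own target is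
  -- the original copy, hence a `punchOut`.
  partner : ∀ k → Vertex (suc k) n → Vertex (suc k) n
  partner k (i , v) = target k (i , v) , vertexAt k (punchOut (punchInᵢ≢i i (index k v)))

  -- A symmetric description of cross edges, free of the distinction which copy index is smaller.
  Linked : ∀ k → Vertex (suc k) n → Vertex (suc k) n → Set
  Linked k x y = target k x ≡ proj₁ y × target k y ≡ proj₁ x

  linked-partner : ∀ k x → Linked k x (partner k x)
  linked-partner k (i , v) = refl ,
    trans (cong (punchIn _) (index-vertexAt k _)) (punchIn-punchOut (punchInᵢ≢i i (index k v)))

  -- Within a copy `j` at most one vertex has a given target, because `punchIn j` and `index k` are
  -- injective.
  linked⇒partner : ∀ k {x y} → Linked k x y → partner k x ≡ y
  linked⇒partner k {i , u} {j , v} (refl , q) = cong (_ ,_)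
    (index-injective k (punchIn-injective _ _ _ (trans (proj₂ (linked-partner k (i , u))) (sym q))))

  partner-involutive : ∀ k x → partner k (partner k x) ≡ x
  partner-involutive k x = linked⇒partner k (swap (linked-partner k x))

  linked⇒Adj : ∀ k {x y} → Linked k x y → Adj (suc k) n x y
  linked⇒Adj k {i , u} {j , v} (p , q)
    with toℕ-punchIn i (index k u) | toℕ-punchIn j (index k v)
  ... | r | s rewrite p | q | toℕ-index k u | toℕ-index k v with r | s
  ... | inj₁ (i<j , u≡) | inj₁ (j<i , v≡) = contradiction j<i (<-asym i<j)
  ... | inj₁ (i<j , u≡) | inj₂ (_ , v≡) = inj₂ (inj₁ (i<j , u≡ , v≡))
  ... | inj₂ (j<i , u≡) | inj₁ (_ , v≡) = inj₂ (inj₂ (j<i , v≡ , u≡))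
  ... | inj₂ (j<i , u≡) | inj₂ (i<j , v≡) = contradiction j<i (<-asym i<j)

  Adj⇒linked : ∀ k {i j u v} → Adj (suc k) n (i , u) (j , v) → (i ≡ j × Adj k n u v) ⊎ Linked k (i , u) (j , v)
  Adj⇒linked k (inj₁ p) = inj₁ p
  Adj⇒linked k {u = u} {v} (inj₂ (inj₁ (i<j , u≡ , v≡))) =
    inj₂ (punchIn-above i<j (trans (toℕ-index k u) u≡) , punchIn-below i<j (trans (toℕ-index k v) v≡))
  Adj⇒linked k {u = u} {v} (inj₂ (inj₂ (j<i , v≡ , u≡))) =
    inj₂ (punchIn-below j<i (trans (toℕ-index k u) u≡) , punchIn-above j<i (trans (toℕ-index k v) v≡))

  Adj-sym : ∀ k {x y} → Adj k n x y → Adj k n y x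
  Adj-sym zero    x≢y = x≢y ∘ sym
  Adj-sym (suc k) (inj₁ (refl , xy)) = inj₁ (refl , Adj-sym k xy)
  Adj-sym (suc k) (inj₂ (inj₁ p)) = inj₂ (inj₂ p)
  Adj-sym (suc k) (inj₂ (inj₂ p)) = inj₂ (inj₁ p)

  -- Enumeration of vertices and arcs.

  vertices : ∀ k → List (Vertex k n)
  vertices zero    = allFin n
  vertices (suc k) = cartesianProduct (copies k) (vertices k)

  ∈-vertices : ∀ k v → v ∈ vertices k
  ∈-vertices zero    v       = ∈-allFin v
  ∈-vertices (suc k) (i , v) = ∈-cartesianProduct⁺ (∈-allFin i) (∈-vertices k v)

  vertices-unique : ∀ k → Unique (vertices k)
  vertices-unique zero    = Unique.allFin⁺ n
  vertices-unique (suc k) = Unique.cartesianProduct⁺ (Unique.allFin⁺ _) (vertices-unique k)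

  inCopy : ∀ {k} → Fin (suc (t k n)) × (Vertex k n × Vertex k n) → Vertex (suc k) n × Vertex (suc k) n
  inCopy (i , u , v) = (i , u) , (i , v)

  -- Every edge occurs once in each direction; at level 0 the diagonal is included, which is harmless since no loop crosses a cut.
  arcs : ∀ k → List (Vertex k n × Vertex k n)
  arcs zero    = cartesianProduct (allFin n) (allFin n)
  arcs (suc k) = map inCopy (cartesianProduct (copies k) (arcs k)) ++ map (λ x → x , partner k x) (vertices (suc k))

  arcs-unique : ∀ k → Unique (arcs k)
  arcs-unique zero    = Unique.cartesianProduct⁺ (Unique.allFin⁺ n) (Unique.allFin⁺ n)
  arcs-unique (suc k) = Unique.++⁺
    (Unique.map⁺ (λ { refl → refl }) (Unique.cartesianProduct⁺ (Unique.allFin⁺ _) (arcs-unique k)))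
    (Unique.map⁺ (λ { refl → refl }) (vertices-unique (suc k)))
    disjoint
    where
    disjoint : ∀ {e} → ¬ (e ∈ map inCopy (cartesianProduct (copies k) (arcs k)) × e ∈ map (λ x → x , partner k x) (vertices (suc k)))
    disjoint (p , q) with ∈-map⁻ _ p | ∈-map⁻ _ q
    -- An arc inside a copy keeps the copy index, whereas a cross arc changes it.
    ... | _ , _ , refl | (i , v) , _ , eq = punchInᵢ≢i i (index k v)
      (trans (sym (cong (proj₁ ∘ proj₂) eq)) (cong (proj₁ ∘ proj₁) eq))

  Adj⇒arc : ∀ k {x y} → Adj k n x y → (x , y) ∈ arcs k
  Adj⇒arc zero    {x} {y} _ = ∈-cartesianProduct⁺ (∈-allFin x) (∈-allFin y)
  Adj⇒arc (suc k) {i , u} {j , v} adj with Adj⇒linked k adj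
  ... | inj₁ (refl , uv) = ∈-++⁺ˡ (∈-map⁺ inCopy (∈-cartesianProduct⁺ (∈-allFin i) (Adj⇒arc k uv)))
  ... | inj₂ l = ∈-++⁺ʳ (map inCopy _)
    (subst (λ y → ((i , u) , y) ∈ map (λ x → x , partner k x) (vertices (suc k))) (linked⇒partner k l)
      (∈-map⁺ (λ x → x , partner k x) (∈-vertices (suc k) (i , u))))

  arc⇒Adj : ∀ k {x y} → (x , y) ∈ arcs k → x ≢ y → Adj k n x y
  arc⇒Adj zero    _ x≢y = x≢y
  arc⇒Adj (suc k) p x≢y with ∈-++⁻ (map inCopy _) p
  ... | inj₁ q with ∈-map⁻ inCopy q
  ... | (i , u , v) , r , refl =
    inj₁ (refl , arc⇒Adj k (proj₂ (∈-cartesianProduct⁻ (copies k) (arcs k) r)) (x≢y ∘ cong (i ,_)))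
  arc⇒Adj (suc k) p x≢y | inj₂ q with ∈-map⁻ _ q
  ... | x , _ , refl = linked⇒Adj k (linked-partner k x)

  -- Size, cut and weight of a vertex set.

  size : ∀ k → (Vertex k n → Bool) → ℕ
  size k χ = ∑ (vertices k) (λ v → ⟦ χ v ⟧)

  cut : ∀ k → (Vertex k n → Bool) → ℕ
  cut k χ = ∑ (arcs k) (λ e → ⟦ crosses χ e ⟧)

  -- The cut of a set within a D_k all of whose vertices have c further edges leaving the D_k.
  weight : ∀ k → ℕ → (Vertex k n → Bool) → ℕ
  weight k c χ = cut k χ + c * size k χ

  out : ∀ k → (Vertex (suc k) n → Bool) → Fin (suc (t k n)) → ℕ
  out k χ i = ∑ (vertices k) (λ v → ⟦ crosses χ ((i , v) , partner k (i , v)) ⟧)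

  size-member : ∀ k χ v → χ v ≡ true → 1 ≤ size k χ
  size-member k χ v eq = ≤-trans (≤-reflexive (cong ⟦_⟧ (sym eq))) (∑-member (λ v → ⟦ χ v ⟧) (∈-vertices k v))

  size-0 : ∀ k χ → size k χ ≡ 0 → ∀ v → χ v ≡ false
  size-0 k χ eq v with χ v in χv
  ... | false = refl
  ... | true  = contradiction (size-member k χ v χv) (<⇒≱ (s≤s (≤-reflexive eq)))

  size-co-co : ∀ k χ → size k (co (co χ)) ≡ size k χ
  size-co-co k χ = ∑-cong (vertices k) (λ v → cong ⟦_⟧ (not-involutive (χ v)))

  length≤size : ∀ k χ {L} → Unique L → All (λ v → χ v ≡ true) L → length L ≤ size k χ
  length≤size k χ {L} u p = begin
    length L             ≡⟨ ∑-1 L ⟨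
    ∑ L (λ _ → 1)        ≤⟨ ∑-true p ⟩
    ∑ L (λ v → ⟦ χ v ⟧)  ≤⟨ ∑-⊆ _ u (λ {v} _ → ∈-vertices k v) ⟩
    size k χ             ∎
    where
    open ≤-Reasoning
    ∑-true : ∀ {L} → All (λ v → χ v ≡ true) L → ∑ L (λ _ → 1) ≤ ∑ L (λ v → ⟦ χ v ⟧)
    ∑-true []       = z≤n
    ∑-true (e ∷ es) = +-mono-≤ (≤-reflexive (cong ⟦_⟧ (sym e))) (∑-true es)

  cut-cross : ∀ k χ → cut (suc k) χ ≡
    ∑ (copies k) (λ i → cut k (copy χ i)) + ∑ (vertices (suc k)) (λ x → ⟦ crosses χ (x , partner k x) ⟧)
  cut-cross k χ = trans (∑-++ (map inCopy (cartesianProduct (copies k) (arcs k))) _ f)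
    (cong₂ _+_ (trans (∑-map inCopy (cartesianProduct (copies k) (arcs k)) f) (∑-× (copies k) (arcs k) (f ∘ inCopy)))
               (∑-map (λ x → x , partner k x) (vertices (suc k)) f))
    where
    f : Vertex (suc k) n × Vertex (suc k) n → ℕ
    f e = ⟦ crosses χ e ⟧

  cut-suc : ∀ k χ → cut (suc k) χ ≡ ∑ (copies k) (λ i → cut k (copy χ i) + out k χ i)
  cut-suc k χ = trans (cut-cross k χ)
    (trans (cong (∑ (copies k) (λ i → cut k (copy χ i)) +_) (∑-× (copies k) (vertices k) _))
           (sym (∑-+ (copies k) (λ i → cut k (copy χ i)) (out k χ))))

  size-suc : ∀ k χ → size (suc k) χ ≡ ∑ (copies k) (λ i → size k (copy χ i))
  size-suc k χ = ∑-× (copies k) (vertices k) _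

  -- Each boundary cross edge is charged to the copy that contains its end in the set.
  weight-suc : ∀ k c χ → weight (suc k) c χ ≡ ∑ (copies k) (λ i → weight k c (copy χ i) + out k χ i)
  weight-suc k c χ = begin
    cut (suc k) χ + c * size (suc k) χ
      ≡⟨ cong₂ (λ x y → x + c * y) (cut-suc k χ) (size-suc k χ) ⟩
    ∑ (copies k) (λ i → cut′ i + out′ i) + c * ∑ (copies k) size′
      ≡⟨ cong (∑ (copies k) (λ i → cut′ i + out′ i) +_) (sym (∑-* (copies k) c size′)) ⟩
    ∑ (copies k) (λ i → cut′ i + out′ i) + ∑ (copies k) (λ i → c * size′ i)
      ≡⟨ sym (∑-+ (copies k) (λ i → cut′ i + out′ i) (λ i → c * size′ i)) ⟩
    ∑ (copies k) (λ i → cut′ i + out′ i + c * size′ i)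
      ≡⟨ ∑-cong (copies k) (λ i → rearrange (cut′ i) (out′ i) (c * size′ i)) ⟩
    ∑ (copies k) (λ i → cut′ i + c * size′ i + out′ i) ∎
    where
    open ≡-Reasoning
    cut′ out′ size′ : Fin (suc (t k n)) → ℕ
    cut′ i  = cut k (copy χ i)
    out′ i  = out k χ i
    size′ i = size k (copy χ i)
    rearrange : ∀ x y z → x + y + z ≡ x + z + y
    rearrange = solve-∀

  -- Distribution of a set over the copies.

  Nonempty : ∀ k → (Vertex (suc k) n → Bool) → Fin (suc (t k n)) → Set
  Nonempty k χ i = 1 ≤ size k (copy χ i)

  nonempty? : ∀ k χ → Decidable (Nonempty k χ)
  nonempty? k χ i = 1 ≤? size k (copy χ i)

  occupied : ∀ k → (Vertex (suc k) n → Bool) → List (Fin (suc (t k n)))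
  occupied k χ = filter (nonempty? k χ) (copies k)

  targets-unique : ∀ k i → Unique (i ∷ map (λ v → target k (i , v)) (vertices k))
  targets-unique k i =
    All.map⁺ (All.tabulate (λ {v} _ eq → punchInᵢ≢i i (index k v) (sym eq))) ∷
    Unique.map⁺ (λ eq → index-injective k (punchIn-injective i _ _ eq)) (vertices-unique k)

  -- The cross edges of a copy end in distinct copies, so at most length (occupied k χ) ∸ 1 of them end in the set.
  size≤out : ∀ k χ i → Nonempty k χ i → size k (copy χ i) + 1 ≤ out k χ i + length (occupied k χ)
  size≤out k χ i ne = begin
    size k (copy χ i) + 1
      ≤⟨ +-monoˡ-≤ 1 (∑-mono (vertices k) pointwise) ⟩
    ∑ (vertices k) (λ v → ⟦ crosses χ ((i , v) , partner k (i , v)) ⟧ + occ (target k (i , v))) + 1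
      ≡⟨ cong (_+ 1) (∑-+ (vertices k) _ _) ⟩
    out k χ i + ∑ (vertices k) (λ v → occ (target k (i , v))) + 1
      ≡⟨ rearrange (out k χ i) _ ⟩
    out k χ i + (1 + ∑ (vertices k) (λ v → occ (target k (i , v))))
      ≡⟨ cong (out k χ i +_) (cong₂ _+_ (sym (occ-1 ne)) (sym (∑-map (λ v → target k (i , v)) (vertices k) occ))) ⟩
    out k χ i + ∑ (i ∷ map (λ v → target k (i , v)) (vertices k)) occ
      ≤⟨ +-monoʳ-≤ (out k χ i) (∑-⊆ occ (targets-unique k i) (λ {j} _ → ∈-allFin j)) ⟩
    out k χ i + ∑ (copies k) occ
      ≡⟨ cong (out k χ i +_) (sym (length-filter (nonempty? k χ) (copies k))) ⟩
    out k χ i + length (occupied k χ) ∎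
    where
    open ≤-Reasoning
    rearrange : ∀ x y → x + y + 1 ≡ x + (1 + y)
    rearrange = solve-∀
    occ : Fin (suc (t k n)) → ℕ
    occ j = ⟦ does (nonempty? k χ j) ⟧
    occ-1 : ∀ {j} → Nonempty k χ j → occ j ≡ 1
    occ-1 {j} ne = cong ⟦_⟧ (dec-true (nonempty? k χ j) ne)
    pointwise : ∀ v → ⟦ χ (i , v) ⟧ ≤ ⟦ crosses χ ((i , v) , partner k (i , v)) ⟧ + occ (target k (i , v))
    pointwise v with χ (i , v) | χ (partner k (i , v)) in eq
    ... | false | _     = z≤n
    ... | true  | false = s≤s z≤n
    ... | true  | true  = ≤-reflexive (sym (occ-1 (size-member k (copy χ _) _ eq)))

  -- With one or two occupied copies the cross edges are absorbed by raising `c` to `suc c`; in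
  -- `two` the edge joining the copies may stay inside the set and is counted at both ends, hence
  -- the 2. In `many` the cross edges are dropped, `c` stays, and three of the occupied copies are
  -- kept.
  data Spread (k c : ℕ) (χ : Vertex (suc k) n → Bool) : Set where
    one  : ∀ i → size k (copy χ i) ≡ size (suc k) χ →
           weight k (suc c) (copy χ i) ≤ weight (suc k) c χ → Spread k c χ
    two  : ∀ i j → Nonempty k χ i → Nonempty k χ j →
           size k (copy χ i) + size k (copy χ j) ≡ size (suc k) χ →
           weight k (suc c) (copy χ i) + weight k (suc c) (copy χ j) ≤ weight (suc k) c χ + 2 → Spread k c χ
    many : ∀ i j l → Nonempty k χ i → Nonempty k χ j → Nonempty k χ l →
           weight k c (copy χ i) + weight k c (copy χ j) + weight k c (copy χ l) ≤ weight (suc k) c χ →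
           Spread k c χ

  spread : ∀ k c χ → 1 ≤ size (suc k) χ → Spread k c χ
  spread k c χ pos = go (occupied k χ) refl (All.all-filter (nonempty? k χ) (copies k)) size-eq weight-le
    where
    open ≤-Reasoning
    size′ cut′ out′ weight′ share : Fin (suc (t k n)) → ℕ
    size′ i   = size k (copy χ i)
    cut′ i    = cut k (copy χ i)
    out′ i    = out k χ i
    weight′ i = weight k (suc c) (copy χ i)
    share i   = weight k c (copy χ i) + out k χ i

    size-eq : ∑ (occupied k χ) size′ ≡ size (suc k) χ
    size-eq = trans (∑-filter (nonempty? k χ) (copies k) (λ i ¬ne → n<1⇒n≡0 (≰⇒> ¬ne))) (sym (size-suc k χ))

    weight-le : ∑ (occupied k χ) share ≤ weight (suc k) c χ
    weight-le = begin
      ∑ (occupied k χ) share ≤⟨ ∑-⊆ share (Unique.filter⁺ (nonempty? k χ) (Unique.allFin⁺ _)) (λ {j} _ → ∈-allFin j) ⟩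
      ∑ (copies k) share     ≡⟨ weight-suc k c χ ⟨
      weight (suc k) c χ     ∎

    -- By `size≤out` all but at most `m` vertices of the set in copy `i` send their cross edge out
    -- of the set, so `out` pays for one further edge per vertex up to the defect `m`.
    absorb : ∀ {i m} → Nonempty k χ i → length (occupied k χ) ≡ suc m → weight′ i ≤ share i + m
    absorb {i} {m} ne eq = begin
      cut′ i + (size′ i + c * size′ i)   ≤⟨ +-monoʳ-≤ (cut′ i) (+-monoˡ-≤ (c * size′ i) size≤) ⟩
      cut′ i + (out′ i + m + c * size′ i) ≡⟨ rearrange (cut′ i) (out′ i) m (c * size′ i) ⟩
      cut′ i + c * size′ i + out′ i + m  ∎
      where
      size≤ : size′ i ≤ out′ i + m
      size≤ = +-cancelʳ-≤ 1 _ _ (≤-trans (size≤out k χ i ne) (≤-reflexive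
        (trans (cong (out′ i +_) (trans eq (+-comm 1 m))) (sym (+-assoc (out′ i) m 1)))))
      rearrange : ∀ x y m z → x + (y + m + z) ≡ x + z + y + m
      rearrange = solve-∀

    go : ∀ S → occupied k χ ≡ S → All (Nonempty k χ) S → ∑ S size′ ≡ size (suc k) χ →
         ∑ S share ≤ weight (suc k) c χ → Spread k c χ
    go [] _ _ eq _ = contradiction pos (<⇒≱ (s≤s (≤-reflexive (sym eq))))
    go (i ∷ []) S≡ (p ∷ _) eq le = one i (trans (sym (+-identityʳ _)) eq) (begin
      weight′ i      ≤⟨ absorb p (cong length S≡) ⟩
      share i + 0    ≤⟨ le ⟩
      weight (suc k) c χ ∎)
    go (i ∷ j ∷ []) S≡ (p ∷ q ∷ _) eq le = two i j p q (trans (cong (size′ i +_) (sym (+-identityʳ _))) eq) (begin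
      weight′ i + weight′ j                ≤⟨ +-mono-≤ (absorb p (cong length S≡)) (absorb q (cong length S≡)) ⟩
      share i + 1 + (share j + 1)          ≡⟨ rearrange (share i) (share j) ⟩
      share i + (share j + 0) + 2          ≤⟨ +-monoˡ-≤ 2 le ⟩
      weight (suc k) c χ + 2               ∎)
      where
      rearrange : ∀ x y → x + 1 + (y + 1) ≡ x + (y + 0) + 2
      rearrange = solve-∀
    go (i ∷ j ∷ l ∷ S) S≡ (p ∷ q ∷ r ∷ _) eq le = many i j l p q r (begin
      weight k c (copy χ i) + weight k c (copy χ j) + weight k c (copy χ l)
        ≤⟨ +-mono-≤ (+-mono-≤ (m≤m+n (w i) (out′ i)) (m≤m+n (w j) (out′ j))) (m≤m+n (w l) (out′ l)) ⟩
      share i + share j + share l           ≤⟨ m≤m+n _ (∑ S share) ⟩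
      share i + share j + share l + ∑ S share ≡⟨ rearrange (share i) (share j) (share l) (∑ S share) ⟩
      share i + (share j + (share l + ∑ S share)) ≤⟨ le ⟩
      weight (suc k) c χ ∎)
      where
      w : Fin (suc (t k n)) → ℕ
      w i = weight k c (copy χ i)
      rearrange : ∀ x y z w → x + y + z + w ≡ x + (y + (z + w))
      rearrange = solve-∀

  -- Complements, orders and the complete graph at level 0.

  length-vertices : ∀ k → length (vertices k) ≡ t k n
  length-vertices zero    = length-tabulate id
  length-vertices (suc k) = trans (length-cartesianProduct (copies k) (vertices k))
    (cong₂ _*_ (length-tabulate {n = suc (t k n)} id) (length-vertices k))

  size-co : ∀ k χ → size k χ + size k (co χ) ≡ t k n
  size-co k χ = begin
    size k χ + size k (co χ)                         ≡⟨ ∑-+ (vertices k) _ _ ⟨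
    ∑ (vertices k) (λ v → ⟦ χ v ⟧ + ⟦ not (χ v) ⟧)   ≡⟨ ∑-cong (vertices k) (λ v → either (χ v)) ⟩
    ∑ (vertices k) (λ _ → 1)                         ≡⟨ ∑-1 (vertices k) ⟩
    length (vertices k)                              ≡⟨ length-vertices k ⟩
    t k n                                            ∎
    where
    open ≡-Reasoning
    either : ∀ b → ⟦ b ⟧ + ⟦ not b ⟧ ≡ 1
    either true  = refl
    either false = refl

  cut-zero : ∀ χ → cut 0 χ ≡ size 0 χ * size 0 (co χ)
  cut-zero χ = begin
    cut 0 χ                                                  ≡⟨ ∑-× (allFin n) (allFin n) _ ⟩
    ∑ (allFin n) (λ u → ∑ (allFin n) (λ v → ⟦ χ u ∧ not (χ v) ⟧)) ≡⟨ ∑-cong (allFin n) row ⟩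
    ∑ (allFin n) (λ u → size 0 (co χ) * ⟦ χ u ⟧)             ≡⟨ ∑-* (allFin n) (size 0 (co χ)) (λ u → ⟦ χ u ⟧) ⟩
    size 0 (co χ) * size 0 χ                                 ≡⟨ *-comm (size 0 (co χ)) _ ⟩
    size 0 χ * size 0 (co χ)                                 ∎
    where
    open ≡-Reasoning
    row : ∀ u → ∑ (allFin n) (λ v → ⟦ χ u ∧ not (χ v) ⟧) ≡ size 0 (co χ) * ⟦ χ u ⟧
    row u with χ u
    ... | true  = sym (*-identityʳ _)
    ... | false = trans (∑-0 (allFin n) (λ _ → refl)) (sym (*-zeroʳ (size 0 (co χ))))

  -- Reversing arcs exchanges the two cuts. Inside copies this is induction; on cross arcs reversal
  -- is reindexing along the involution `partner`.
  cut-co : ∀ k χ → cut k (co χ) ≤ cut k χ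
  cut-co zero    χ = ≤-reflexive (begin
    cut 0 (co χ)                           ≡⟨ cut-zero (co χ) ⟩
    size 0 (co χ) * size 0 (co (co χ))     ≡⟨ cong (size 0 (co χ) *_) (size-co-co 0 χ) ⟩
    size 0 (co χ) * size 0 χ               ≡⟨ *-comm (size 0 (co χ)) _ ⟩
    size 0 χ * size 0 (co χ)               ≡⟨ cut-zero χ ⟨
    cut 0 χ                                ∎)
    where open ≡-Reasoning
  cut-co (suc k) χ = begin
    cut (suc k) (co χ) ≡⟨ cut-cross k (co χ) ⟩
    ∑ (copies k) (λ i → cut k (co (copy χ i))) + ∑ vs (λ x → ⟦ crosses (co χ) (x , partner k x) ⟧)
      ≤⟨ +-mono-≤ (∑-mono (copies k) (λ i → cut-co k (copy χ i))) cross ⟩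
    ∑ (copies k) (λ i → cut k (copy χ i)) + ∑ vs f ≡⟨ cut-cross k χ ⟨
    cut (suc k) χ ∎
    where
    open ≤-Reasoning
    vs : List (Vertex (suc k) n)
    vs = vertices (suc k)
    f : Vertex (suc k) n → ℕ
    f x = ⟦ crosses χ (x , partner k x) ⟧
    reverse : ∀ a b → not a ∧ not (not b) ≡ b ∧ not a
    reverse true  true  = refl
    reverse true  false = refl
    reverse false true  = refl
    reverse false false = refl
    cross : ∑ vs (λ x → ⟦ crosses (co χ) (x , partner k x) ⟧) ≤ ∑ vs f
    cross = begin
      ∑ vs (λ x → ⟦ crosses (co χ) (x , partner k x) ⟧) ≡⟨ ∑-cong vs (λ x → cong ⟦_⟧ (trans (reverse (χ x) (χ (partner k x)))
        (cong (λ y → χ (partner k x) ∧ not (χ y)) (sym (partner-involutive k x))))) ⟩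
      ∑ vs (f ∘ partner k)      ≡⟨ ∑-map (partner k) vs f ⟨
      ∑ (map (partner k) vs) f  ≤⟨ ∑-⊆ f (Unique.map⁺ partner-injective (vertices-unique (suc k))) (λ {x} _ → ∈-vertices (suc k) x) ⟩
      ∑ vs f                    ∎
      where
      partner-injective : ∀ {x y} → partner k x ≡ partner k y → x ≡ y
      partner-injective {x} {y} eq =
        trans (sym (partner-involutive k x)) (trans (cong (partner k) eq) (partner-involutive k y))

  -- Passing to the next level adds `t k n * t k n`, which is at least 1, to the order.
  n+k≤t : 3 ≤ n → ∀ k → n + k ≤ t k n
  n+k≤t 3≤n zero    = ≤-reflexive (+-identityʳ n)
  n+k≤t 3≤n (suc k) = begin
    n + suc k            ≡⟨ trans (+-suc n k) (+-comm 1 (n + k)) ⟩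
    n + k + 1            ≤⟨ +-mono-≤ ih (*-mono-≤ 1≤t 1≤t) ⟩
    t k n + t k n * t k n ∎
    where
    open ≤-Reasoning
    ih : n + k ≤ t k n
    ih = n+k≤t 3≤n k
    1≤t : 1 ≤ t k n
    1≤t = ≤-trans (≤-trans (≤-trans (s≤s z≤n) 3≤n) (m≤m+n n k)) ih

  weight-zero : ∀ c χ → weight 0 c χ ≡ size 0 χ * (size 0 (co χ) + c)
  weight-zero c χ = trans (cong (_+ c * size 0 χ) (cut-zero χ))
    (trans (cong (size 0 χ * size 0 (co χ) +_) (*-comm c _)) (sym (*-distribˡ-+ (size 0 χ) _ c)))

  degree-zero : ∀ c χ → n + c ≡ size 0 χ + (size 0 (co χ) + c)
  degree-zero c χ = trans (cong (_+ c) (sym (size-co 0 χ))) (+-assoc (size 0 χ) _ c)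

  -- In a complete graph with `p` vertices inside and `q` outside the weight is `p * (q + c)`, while
  -- the two factors add up to `n + c`; `product-bound` applies to them.
  weight-zero-bound : ∀ j c χ → j ≤ size 0 χ → j ≤ size 0 (co χ) + c → j * (n + c) ≤ weight 0 c χ + j * j
  weight-zero-bound j c χ p q = subst₂ (λ x y → j * x ≤ y + j * j)
    (sym (degree-zero c χ)) (sym (weight-zero c χ)) (product-bound j p q)

  -- Full and empty copies.

  Connected : ℕ → Set
  Connected k = ∀ χ → 1 ≤ size k χ → 1 ≤ size k (co χ) → 1 ≤ cut k χ

  NoFullCopy : ∀ k → (Vertex (suc k) n → Bool) → Set
  NoFullCopy k χ = ∀ i → 1 ≤ size k (co (copy χ i))

  -- Every copy other than the full copy f is joined to f by an edge; charge to it that edge if its end lies outside the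
  -- set, and otherwise a boundary edge inside the copy or, if the copy is full, its edge to the empty copy e.
  full-and-empty : ∀ k χ f e → Connected k → size k (co (copy χ f)) ≡ 0 → size k (copy χ e) ≡ 0 → t k n ≤ cut (suc k) χ
  full-and-empty k χ f e connected full empty = begin
    t k n                       ≡⟨ length-vertices k ⟨
    length (vertices k)         ≡⟨ ∑-1 (vertices k) ⟨
    ∑ (vertices k) (λ _ → 1)    ≤⟨ ∑-mono (vertices k) charge ⟩
    ∑ (vertices k) (λ v → ⟦ crosses χ ((f , v) , partner k (f , v)) ⟧ + share (target k (f , v)))
                                ≡⟨ ∑-+ (vertices k) _ _ ⟩
    out k χ f + ∑ (vertices k) (λ v → share (target k (f , v)))
                                ≤⟨ +-monoˡ-≤ _ (m≤n+m (out k χ f) (cut k (copy χ f))) ⟩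
    share f + ∑ (vertices k) (λ v → share (target k (f , v)))
                                ≡⟨ cong (share f +_) (∑-map (λ v → target k (f , v)) (vertices k) share) ⟨
    ∑ (f ∷ map (λ v → target k (f , v)) (vertices k)) share
                                ≤⟨ ∑-⊆ share (targets-unique k f) (λ {j} _ → ∈-allFin j) ⟩
    ∑ (copies k) share          ≡⟨ cut-suc k χ ⟨
    cut (suc k) χ               ∎
    where
    open ≤-Reasoning
    share : Fin (suc (t k n)) → ℕ
    share i = cut k (copy χ i) + out k χ i

    χ-full : ∀ g → size k (co (copy χ g)) ≡ 0 → ∀ v → χ (g , v) ≡ true
    χ-full g eq v = trans (sym (not-involutive _)) (cong not (size-0 k _ eq v))

    share-nonempty : ∀ g → Nonempty k χ g → 1 ≤ share g
    share-nonempty g ne with 1 ≤? size k (co (copy χ g))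
    ... | yes mixed = ≤-trans (connected _ ne mixed) (m≤m+n _ _)
    ... | no ¬mixed = ≤-trans (subst (λ b → ⟦ b ⟧ ≤ out k χ g) crossing (∑-member _ (∈-vertices k v))) (m≤n+m _ _)
      where
      g≢e : g ≢ e
      g≢e refl = contradiction ne (<⇒≱ (s≤s (≤-reflexive empty)))
      v : Vertex k n
      v = vertexAt k (punchOut g≢e)
      target≡e : target k (g , v) ≡ e
      target≡e = trans (cong (punchIn g) (index-vertexAt k _)) (punchIn-punchOut g≢e)
      crossing : crosses χ ((g , v) , partner k (g , v)) ≡ true
      crossing = cong₂ (λ a b → a ∧ not b) (χ-full g (n<1⇒n≡0 (≰⇒> ¬mixed)) v)
        (size-0 k (copy χ (target k (g , v))) (trans (cong (λ i → size k (copy χ i)) target≡e) empty) _)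

    charge : ∀ v → 1 ≤ ⟦ crosses χ ((f , v) , partner k (f , v)) ⟧ + share (target k (f , v))
    charge v rewrite χ-full f full v with χ (partner k (f , v)) in eq
    ... | false = s≤s z≤n
    ... | true  = share-nonempty _ (size-member k (copy χ _) _ eq)

  -- If no copy is full, `bound` applies to the set. If some copy is full and none is empty, the
  -- complement has no full copy and `bound` applies to it. If both kinds occur, `full-and-empty`
  -- already gives `t k n` edges.
  cut-from-no-full : ∀ k l {b d} → Connected k → b ≤ t k n + d →
    (∀ χ → NoFullCopy k χ → l ≤ size (suc k) χ → b ≤ cut (suc k) χ + d) →
    ∀ χ → l ≤ size (suc k) χ → l ≤ size (suc k) (co χ) → b ≤ cut (suc k) χ + d
  cut-from-no-full k l {b} {d} connected b≤t bound χ p q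
    with Fin.any? (λ i → size k (co (copy χ i)) ≟ 0) | Fin.any? (λ i → size k (copy χ i) ≟ 0)
  ... | yes (f , full) | yes (e , empty) = ≤-trans b≤t (+-monoˡ-≤ d (full-and-empty k χ f e connected full empty))
  ... | no noFull | _ = bound χ (λ i → n≢0⇒n>0 (λ eq → noFull (i , eq))) p
  ... | yes _ | no noEmpty = ≤-trans
    (bound (co χ) (λ i → n≢0⇒n>0 (λ eq → noEmpty (i , trans (sym (size-co-co k (copy χ i))) eq))) q)
    (+-monoˡ-≤ d (cut-co (suc k) χ))

  -- Boundaries as edge sets.

  weight-0 : ∀ k χ → weight k 0 χ ≡ cut k χ
  weight-0 k χ = +-identityʳ (cut k χ)

  cut-false : ∀ k χ → (∀ v → χ v ≡ false) → cut k χ ≡ 0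
  cut-false k χ eq = ∑-0 (arcs k) (λ (u , v) → cong (λ b → ⟦ b ∧ not (χ v) ⟧) (eq u))

  Adj-irrefl : ∀ k {x} → ¬ Adj k n x x
  Adj-irrefl zero    x≢x = x≢x refl
  Adj-irrefl (suc k) (inj₁ (_ , xx)) = Adj-irrefl k xx
  Adj-irrefl (suc k) (inj₂ (inj₁ (lt , _))) = <-irrefl refl lt
  Adj-irrefl (suc k) (inj₂ (inj₂ (lt , _))) = <-irrefl refl lt

  boundary : ∀ k → (Vertex k n → Bool) → List (Vertex k n × Vertex k n)
  boundary k χ = filter (T? ∘ crosses χ) (arcs k)

  length-boundary : ∀ k χ → length (boundary k χ) ≡ cut k χ
  length-boundary k χ = length-filter (T? ∘ crosses χ) (arcs k)

  ∈-boundary⁻ : ∀ k χ {u v} → (u , v) ∈ boundary k χ → Adj k n u v × χ u ≡ true × χ v ≡ false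
  ∈-boundary⁻ k χ {u} {v} p with ∈-filter⁻ (T? ∘ crosses χ) {xs = arcs k} p
  ... | arc , cr with χ u in χu | χ v in χv
  ... | true | false = arc⇒Adj k arc (λ { refl → case trans (sym χu) χv of λ () }) , refl , refl

  ∈-boundary⁺ : ∀ k χ {u v} → Adj k n u v → χ u ≡ true → χ v ≡ false → (u , v) ∈ boundary k χ
  ∈-boundary⁺ k χ adj χu χv = ∈-filter⁺ (T? ∘ crosses χ) (Adj⇒arc k adj)
    (subst T (sym (cong₂ (λ a b → a ∧ not b) χu χv)) _)

  boundary-unique : ∀ k χ → Unique (boundary k χ)
  boundary-unique k χ = Unique.filter⁺ (T? ∘ crosses χ) (arcs-unique k)

  -- All listed arcs start inside and end outside, so an arc and its reverse never both occur, and
  -- distinct arcs are distinct undirected edges.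
  boundary-isEdgeSet : ∀ k χ → IsEdgeSet k n (boundary k χ)
  boundary-isEdgeSet k χ = All.tabulate (λ p → proj₁ (∈-boundary⁻ k χ p)) ,
    go (boundary-unique k χ) (All.tabulate (λ p → proj₂ (∈-boundary⁻ k χ p)))
    where
    go : ∀ {es} → Unique es → All (λ (u , v) → χ u ≡ true × χ v ≡ false) es →
         AllPairs (λ e e′ → ¬ SameEdge k n e e′) es
    go []       []       = []
    go (q ∷ qs) ((χu , _) ∷ ps) = All.zipWith distinct (q , ps) ∷ go qs ps
      where
      distinct : ∀ {e} → _ ≢ e × (χ (proj₁ e) ≡ true × χ (proj₂ e) ≡ false) → ¬ SameEdge k n _ e
      distinct (e≢ , _)      (inj₁ (refl , refl)) = e≢ refl
      distinct (_ , _ , χv′) (inj₂ (refl , refl)) = case trans (sym χu) χv′ of λ ()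

  boundary-keeps : ∀ k χ {u v} → Adj k n u v → χ u ≡ χ v → AdjMinus k n (boundary k χ) u v
  boundary-keeps k χ adj eq = adj , λ where
    (inj₁ p) → let _ , χu , χv = ∈-boundary⁻ k χ p in case trans (sym χu) (trans eq χv) of λ ()
    (inj₂ p) → let _ , χv , χu = ∈-boundary⁻ k χ p in case trans (sym χu) (trans eq χv) of λ ()

  boundary-separates : ∀ k χ {u v} → Reach k n (boundary k χ) u v → χ u ≡ χ v
  boundary-separates k χ here = refl
  boundary-separates k χ (step {v} {w} r (adj , kept)) = trans (boundary-separates k χ r) same
    where
    same : χ v ≡ χ w
    same with χ v in χv | χ w in χw
    ... | true  | true  = refl
    ... | false | false = refl
    ... | true  | false = contradiction (inj₁ (∈-boundary⁺ k χ adj χv χw)) kept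
    ... | false | true  = contradiction (inj₂ (∈-boundary⁺ k χ (Adj-sym k adj) χw χv)) kept

  -- Decidability and components after edge removal.

  TwoNeighbours : ∀ k → (Vertex k n → Set) → Vertex k n → Set
  TwoNeighbours k P u = ∃ λ a → ∃ λ b → a ≢ b × (Adj k n u a × P a) × (Adj k n u b × P b)

  _≟ᵛ_ : ∀ {k} → DecidableEquality (Vertex k n)
  _≟ᵛ_ {zero}  = Fin._≟_
  _≟ᵛ_ {suc k} = ≡-dec Fin._≟_ (_≟ᵛ_ {k})

  adj? : ∀ k u v → Dec (Adj k n u v)
  adj? zero    u v = ¬? (u Fin.≟ v)
  adj? (suc k) (i , u) (j , v) =
    (i Fin.≟ j ×-dec adj? k u v)
    ⊎-dec (toℕ i <? toℕ j ×-dec uid k n u ≟ toℕ j ∸ 1 ×-dec uid k n v ≟ toℕ i)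
    ⊎-dec (toℕ j <? toℕ i ×-dec uid k n v ≟ toℕ i ∸ 1 ×-dec uid k n u ≟ toℕ j)

  -- The triangle 0, 1, 2 of the first K_n.
  corner : ∀ k → Vertex k n → Bool
  corner k v = does (uid k n v <? 3)

  module _ (k : ℕ) (F : List (Vertex k n × Vertex k n)) where

    open DecMembership (_≟ᵛ_ {k}) using (_∈?_)
    open DecMembership (≡-dec (_≟ᵛ_ {k}) (_≟ᵛ_ {k})) using () renaming (_∈?_ to _∈ᵉ?_)

    removed? : ∀ u v → Dec (Removed k n F u v)
    removed? u v = ((u , v) ∈ᵉ? F) ⊎-dec ((v , u) ∈ᵉ? F)

    adjMinus? : ∀ u v → Dec (AdjMinus k n F u v)
    adjMinus? u v = adj? k u v ×-dec ¬? (removed? u v)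

    AdjMinus-sym : ∀ {u v} → AdjMinus k n F u v → AdjMinus k n F v u
    AdjMinus-sym (adj , kept) = Adj-sym k adj , kept ∘ Sum.swap

    Reach-trans : ∀ {u v w} → Reach k n F u v → Reach k n F v w → Reach k n F u w
    Reach-trans r here       = r
    Reach-trans r (step s e) = step (Reach-trans r s) e

    Reach-sym : ∀ {u v} → Reach k n F u v → Reach k n F v u
    Reach-sym here       = here
    Reach-sym (step r e) = Reach-trans (step here (AdjMinus-sym e)) (Reach-sym r)

    -- An explicit list makes membership decidable, which turns a component into a Boolean vertex
    -- set.
    record Component (u : Vertex k n) : Set where
      field
        members  : List (Vertex k n)
        unique   : Unique members
        reached  : All (Reach k n F u) members
        complete : ∀ v → Reach k n F u v → v ∈ members

    open Component

    -- Vertices adjacent to the current list are added until it is closed. Each round adds a new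
    -- vertex, so the number of all vertices suffices as fuel: when it runs out, the list is too
    -- long to admit another vertex.
    component : ∀ u → Component u
    component u = grow (length (vertices k)) (u ∷ []) ([] ∷ []) (here ∷ []) (here refl) (m≤m+n _ 1)
      where
      grow : ∀ fuel L → Unique L → All (Reach k n F u) L → u ∈ L → length (vertices k) ≤ fuel + length L → Component u
      grow fuel L uniq rs u∈L enough
        with Any.any? (λ v → ¬? (v ∈? L) ×-dec Any.any? (λ w → adjMinus? w v) L) (vertices k)
      ... | no ¬extends = record { members = L ; unique = uniq ; reached = rs ; complete = λ v → closed }
        where
        closed : ∀ {v} → Reach k n F u v → v ∈ L
        closed here = u∈L
        closed (step {w} {v} r e) with v ∈? L
        ... | yes v∈L = v∈L
        ... | no v∉L  = contradiction
          (lose (∈-vertices k v) (v∉L , lose (closed r) e)) ¬extends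
      ... | yes extends with find extends
      ... | v , _ , v∉L , adjacent with find adjacent
      grow zero L uniq rs u∈L enough | yes extends | v , _ , v∉L , adjacent | w , w∈L , e =
        contradiction enough (<⇒≱ (length-⊆ (All.¬Any⇒All¬ L v∉L ∷ uniq) (λ {x} _ → ∈-vertices k x)))
      grow (suc fuel) L uniq rs u∈L enough | yes extends | v , _ , v∉L , adjacent | w , w∈L , e =
        grow fuel (v ∷ L) (All.¬Any⇒All¬ L v∉L ∷ uniq) (step (All.lookup rs w∈L) e ∷ rs) (there u∈L)
          (≤-trans enough (≤-reflexive (sym (+-suc fuel (length L)))))

    -- The pairs of `F` may be stored in either direction. Once each is turned to start in the set
    -- where possible, the boundary is contained in the resulting list.
    cut≤length : ∀ χ → (∀ {u v} → Adj k n u v → χ u ≡ true → χ v ≡ false → Removed k n F u v) → cut k χ ≤ length F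
    cut≤length χ removed = begin
      cut k χ                    ≡⟨ length-boundary k χ ⟨
      length (boundary k χ)      ≤⟨ length-⊆ (boundary-unique k χ) boundary⊆ ⟩
      length (map orient F)      ≡⟨ length-map orient F ⟩
      length F                   ∎
      where
      open ≤-Reasoning
      orient : Vertex k n × Vertex k n → Vertex k n × Vertex k n
      orient (u , v) = if χ u then (u , v) else (v , u)
      boundary⊆ : boundary k χ ⊆ map orient F
      boundary⊆ {u , v} p with ∈-boundary⁻ k χ p
      ... | adj , χu , χv with removed adj χu χv
      ... | inj₁ q = subst (_∈ map orient F) (cong (λ b → if b then (u , v) else (v , u)) χu) (∈-map⁺ orient q)
      ... | inj₂ q = subst (_∈ map orient F) (cong (λ b → if b then (v , u) else (u , v)) χv) (∈-map⁺ orient q)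

    exactly-or-more : ∀ {u} (C : Component u) → CompAtLeast k n 3 F u → CompExactly k n 3 F u ⊎ 4 ≤ length (members C)
    exactly-or-more C (L , L≡3 , uniq , rs) with length (members C) ≟ 3
    ... | yes eq = inj₁ (members C , eq , unique C , reached C , complete C)
    ... | no neq = inj₂ (≤∧≢⇒< (≤-trans (≤-reflexive (sym L≡3)) (length-⊆ uniq (λ p → complete C _ (All.lookup rs p)))) (neq ∘ sym))

  -- Lower bounds for the weight.

  module _ (3≤n : 3 ≤ n) where

    3≤n+ : ∀ k → 3 ≤ n + k
    3≤n+ k = ≤-trans 3≤n (m≤m+n n k)

    -- The extremal set is a single vertex, of weight `n + k + c - 1`. At level 0 the condition
    -- `1 ≤ c` keeps the factor `q + c` positive even if the set fills the `K_n`.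
    weight-bound₁ : ∀ k c χ → 1 ≤ c → 1 ≤ size k χ → n + (k + c) ≤ weight k c χ + 1
    weight-bound₁ zero    c χ 1≤c p = ≤-trans (≤-reflexive (sym (*-identityˡ (n + c))))
      (weight-zero-bound 1 c χ p (≤-trans 1≤c (m≤n+m c _)))
    weight-bound₁ (suc k) c χ 1≤c p with spread k c χ p
    ... | one i eq le = begin
      n + (suc k + c)                  ≡⟨ cong (n +_) (+-suc k c) ⟨
      n + (k + suc c)                  ≤⟨ weight-bound₁ k (suc c) _ (s≤s z≤n) (≤-trans p (≤-reflexive (sym eq))) ⟩
      weight k (suc c) (copy χ i) + 1  ≤⟨ +-monoˡ-≤ 1 le ⟩
      weight (suc k) c χ + 1           ∎
      where open ≤-Reasoning
    ... | two i j pi pj _ le = double⇒single (3≤n+ _) (subst (λ s → 2 * (n + s) ≤ weight (suc k) c χ + 4) (+-suc k c)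
      (pair-bound₂ (weight-bound₁ k (suc c) _ (s≤s z≤n) pi) (weight-bound₁ k (suc c) _ (s≤s z≤n) pj) le))
    ... | many i j l pi pj pl le = double⇒single (3≤n+ _) (triple⇒double (3≤n+ _)
      (subst (λ s → 3 * s ≤ weight (suc k) c χ + 6) (sym (+-suc n (k + c)))
        (triple-bound (weight-bound₁ k c _ 1≤c pi) (weight-bound₁ k c _ 1≤c pj) (weight-bound₁ k c _ 1≤c pl) le)))

    -- With `e = n + k + c - 1`, the bound is `2e - 2`, the weight of two adjacent vertices. Since
    -- `k + c` is preserved in the case `one`, the condition on it becomes `2 ≤ c` at level 0.
    weight-bound₂ : ∀ k c χ → 1 ≤ c → 2 ≤ k + c → 2 ≤ size k χ → 2 * (n + (k + c)) ≤ weight k c χ + 4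
    weight-bound₂ zero    c χ _ 2≤c p = weight-zero-bound 2 c χ p (≤-trans 2≤c (m≤n+m c _))
    weight-bound₂ (suc k) c χ 1≤c 2≤k+c p with spread k c χ (≤-trans (s≤s z≤n) p)
    ... | one i eq le = begin
      2 * (n + (suc k + c))            ≡⟨ cong (λ s → 2 * (n + s)) (+-suc k c) ⟨
      2 * (n + (k + suc c))            ≤⟨ weight-bound₂ k (suc c) _ (s≤s z≤n)
                                            (≤-trans 2≤k+c (≤-reflexive (sym (+-suc k c)))) (≤-trans p (≤-reflexive (sym eq))) ⟩
      weight k (suc c) (copy χ i) + 4  ≤⟨ +-monoˡ-≤ 4 le ⟩
      weight (suc k) c χ + 4           ∎
      where open ≤-Reasoning
    ... | two i j pi pj _ le = subst (λ s → 2 * (n + s) ≤ weight (suc k) c χ + 4) (+-suc k c)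
      (pair-bound₂ (weight-bound₁ k (suc c) _ (s≤s z≤n) pi) (weight-bound₁ k (suc c) _ (s≤s z≤n) pj) le)
    ... | many i j l pi pj pl le = triple⇒double (3≤n+ _)
      (subst (λ s → 3 * s ≤ weight (suc k) c χ + 6) (sym (+-suc n (k + c)))
        (triple-bound (weight-bound₁ k c _ 1≤c pi) (weight-bound₁ k c _ 1≤c pj) (weight-bound₁ k c _ 1≤c pl) le))

    -- Of four vertices in two copies, two lie in the same copy. That copy obeys `weight-bound₂` and
    -- the other `weight-bound₁`; minus 2 for the shared edge, this is even one better than
    -- required.
    two-copies : ∀ k c χ i j → 1 ≤ k + c → Nonempty k χ i → Nonempty k χ j →
      4 ≤ size k (copy χ i) + size k (copy χ j) →
      weight k (suc c) (copy χ i) + weight k (suc c) (copy χ j) ≤ weight (suc k) c χ + 2 →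
      3 * (n + (suc k + c)) ≤ weight (suc k) c χ + 8
    two-copies k c χ i j 1≤k+c pi pj 4≤ le = subst (λ s → 3 * (n + s) ≤ weight (suc k) c χ + 8) (+-suc k c) (case one-large 4≤ of λ where
      (inj₁ 2≤i) → pair-bound₄ (bound₁ pj) (bound₂ 2≤i) (≤-trans (≤-reflexive (+-comm (weight k (suc c) (copy χ j)) _)) le)
      (inj₂ 2≤j) → pair-bound₄ (bound₁ pi) (bound₂ 2≤j) le)
      where
      bound₁ : ∀ {i} → Nonempty k χ i → n + (k + suc c) ≤ weight k (suc c) (copy χ i) + 1
      bound₁ = weight-bound₁ k (suc c) _ (s≤s z≤n)
      bound₂ : ∀ {i} → 2 ≤ size k (copy χ i) → 2 * (n + (k + suc c)) ≤ weight k (suc c) (copy χ i) + 4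
      bound₂ = weight-bound₂ k (suc c) _ (s≤s z≤n) (≤-trans (s≤s 1≤k+c) (≤-reflexive (sym (+-suc k c))))

    -- With `e = n + k + c - 1`, the bound is `3e - 5`, one more than the weight of a triangle.
    -- Descending through the case `one` turns `4 ≤ k + c` into `4 ≤ c` at level 0, where
    -- `product-bound₄` needs both factors to be at least 4.
    weight-bound₄ : ∀ k c χ → 1 ≤ c → 4 ≤ k + c → 4 ≤ size k χ → 3 * (n + (k + c)) ≤ weight k c χ + 8
    weight-bound₄ zero    c χ _ 4≤c p = subst₂ (λ x y → 3 * x ≤ y + 8)
      (sym (degree-zero c χ)) (sym (weight-zero c χ)) (product-bound₄ p (≤-trans 4≤c (m≤n+m c _)))
    weight-bound₄ (suc k) c χ 1≤c 4≤k+c p with spread k c χ (≤-trans (s≤s z≤n) p)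
    ... | one i eq le = begin
      3 * (n + (suc k + c))            ≡⟨ cong (λ s → 3 * (n + s)) (+-suc k c) ⟨
      3 * (n + (k + suc c))            ≤⟨ weight-bound₄ k (suc c) _ (s≤s z≤n)
                                            (≤-trans 4≤k+c (≤-reflexive (sym (+-suc k c)))) (≤-trans p (≤-reflexive (sym eq))) ⟩
      weight k (suc c) (copy χ i) + 8  ≤⟨ +-monoˡ-≤ 8 le ⟩
      weight (suc k) c χ + 8           ∎
      where open ≤-Reasoning
    ... | two i j pi pj eq le = two-copies k c χ i j (≤-trans (s≤s z≤n) (≤-pred 4≤k+c)) pi pj (≤-trans p (≤-reflexive (sym eq))) le
    ... | many i j l pi pj pl le = ≤-trans
      (subst (λ s → 3 * s ≤ weight (suc k) c χ + 6) (sym (+-suc n (k + c)))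
        (triple-bound (weight-bound₁ k c _ 1≤c pi) (weight-bound₁ k c _ 1≤c pj) (weight-bound₁ k c _ 1≤c pl) le))
      (+-monoʳ-≤ _ (m≤n+m 6 2))

    -- Lower bounds for cuts.

    -- The edge-connectivity is at least the degree `n + k - 1`; the 1 stands on the right to avoid
    -- truncated subtraction.
    EdgeConnected : ℕ → Set
    EdgeConnected k = ∀ χ → 1 ≤ size k χ → 1 ≤ size k (co χ) → n + k ≤ cut k χ + 1

    edgeConnected⇒connected : ∀ k → EdgeConnected k → Connected k
    edgeConnected⇒connected k bound χ p q =
      ≤-trans (s≤s z≤n) (+-cancelʳ-≤ 1 2 _ (≤-trans (3≤n+ k) (bound χ p q)))

    -- Three copies that are neither empty nor full each contain a nontrivial cut, to which
    -- edge-connectivity one level down applies.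
    mixed-copies : ∀ k χ i j l → EdgeConnected k → NoFullCopy k χ →
      Nonempty k χ i → Nonempty k χ j → Nonempty k χ l →
      weight k 0 (copy χ i) + weight k 0 (copy χ j) + weight k 0 (copy χ l) ≤ weight (suc k) 0 χ →
      3 * (n + suc k) ≤ weight (suc k) 0 χ + 6
    mixed-copies k χ i j l bound noFull pi pj pl le =
      subst (λ s → 3 * s ≤ weight (suc k) 0 χ + 6) (sym (+-suc n k)) (triple-bound (mixed i pi) (mixed j pj) (mixed l pl) le)
      where
      mixed : ∀ i → Nonempty k χ i → n + k ≤ weight k 0 (copy χ i) + 1
      mixed i p = subst (λ w → n + k ≤ w + 1) (sym (weight-0 k (copy χ i))) (bound (copy χ i) p (noFull i))

    -- The weight bounds assume `1 ≤ c`, so they enter after one step, which raises `c` from 0 to 1.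
    -- In the case `many`, where `c` stays 0, the induction hypothesis takes their place through
    -- `mixed-copies`.
    cut-bound₁ : ∀ k → EdgeConnected k
    cut-bound₁ zero χ p q = subst₂ _≤_ (*-identityˡ (n + 0)) (cong (_+ 1) (weight-0 0 χ))
      (weight-zero-bound 1 0 χ p (≤-trans q (m≤m+n _ 0)))
    cut-bound₁ (suc k) = cut-from-no-full k 1 (edgeConnected⇒connected k (cut-bound₁ k)) base
      (λ χ noFull p → subst (λ w → n + suc k ≤ w + 1) (weight-0 (suc k) χ) (noFull-bound χ noFull p))
      where
      base : n + suc k ≤ t k n + 1
      base = ≤-trans (≤-reflexive (trans (+-suc n k) (+-comm 1 (n + k)))) (+-monoˡ-≤ 1 (n+k≤t 3≤n k))
      noFull-bound : ∀ χ → NoFullCopy k χ → 1 ≤ size (suc k) χ → n + suc k ≤ weight (suc k) 0 χ + 1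
      noFull-bound χ noFull p with spread k 0 χ p
      ... | one i eq le = begin
        n + suc k                        ≡⟨ cong (n +_) (+-comm 1 k) ⟩
        n + (k + 1)                      ≤⟨ weight-bound₁ k 1 _ ≤-refl (≤-trans p (≤-reflexive (sym eq))) ⟩
        weight k 1 (copy χ i) + 1        ≤⟨ +-monoˡ-≤ 1 le ⟩
        weight (suc k) 0 χ + 1           ∎
        where open ≤-Reasoning
      ... | two i j pi pj _ le = double⇒single (3≤n+ _) (subst (λ s → 2 * (n + s) ≤ weight (suc k) 0 χ + 4) (+-comm k 1)
        (pair-bound₂ (weight-bound₁ k 1 _ ≤-refl pi) (weight-bound₁ k 1 _ ≤-refl pj) le))
      ... | many i j l pi pj pl le = double⇒single (3≤n+ _) (triple⇒double (3≤n+ _)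
        (mixed-copies k χ i j l (cut-bound₁ k) noFull pi pj pl le))

    -- The order grows quadratically: with `s = n + k`, the next order is at least `s + s * s`,
    -- which exceeds `3 * s` because `s ≥ 3`.
    order-bound : ∀ k → 3 ≤ k → 3 * (n + suc k) ≤ t k n + 8
    order-bound (suc k) (s≤s 2≤k) = begin
      3 * (n + suc (suc k))     ≡⟨ lhs n k ⟩
      3 * s + 6                 ≤⟨ +-mono-≤ 3s≤ (m≤n+m 6 2) ⟩
      s + s * s + 8             ≤⟨ +-monoˡ-≤ 8 (+-mono-≤ s≤t (*-mono-≤ s≤t s≤t)) ⟩
      t k n + t k n * t k n + 8 ∎
      where
      open ≤-Reasoning
      s : ℕ
      s = n + k
      s≤t : s ≤ t k n
      s≤t = n+k≤t 3≤n k
      lhs : ∀ n k → 3 * (n + suc (suc k)) ≡ 3 * (n + k) + 6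
      lhs = solve-∀
      3s≤ : 3 * s ≤ s + s * s
      3s≤ = ≤-trans (*-monoˡ-≤ s (≤-trans (3≤n+ k) (n≤1+n _))) ≤-refl

    cut-bound₄ : ∀ k → 4 ≤ k → ∀ χ → 4 ≤ size k χ → 4 ≤ size k (co χ) → 3 * (n + k) ≤ cut k χ + 8
    cut-bound₄ (suc k) (s≤s 3≤k) = cut-from-no-full k 4 (edgeConnected⇒connected k (cut-bound₁ k)) (order-bound k 3≤k)
      (λ χ noFull p → subst (λ w → 3 * (n + suc k) ≤ w + 8) (weight-0 (suc k) χ) (noFull-bound χ noFull p))
      where
      noFull-bound : ∀ χ → NoFullCopy k χ → 4 ≤ size (suc k) χ → 3 * (n + suc k) ≤ weight (suc k) 0 χ + 8
      noFull-bound χ noFull p with spread k 0 χ (≤-trans (s≤s z≤n) p)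
      ... | one i eq le = begin
        3 * (n + suc k)                  ≡⟨ cong (λ s → 3 * (n + s)) (+-comm 1 k) ⟩
        -- The lower bound on the level enters here: a copy has level at least 3 and `c` is now 1,
        -- which gives the sum 4 demanded by `weight-bound₄`.
        3 * (n + (k + 1))                ≤⟨ weight-bound₄ k 1 _ ≤-refl (+-monoˡ-≤ 1 3≤k) (≤-trans p (≤-reflexive (sym eq))) ⟩
        weight k 1 (copy χ i) + 8        ≤⟨ +-monoˡ-≤ 8 le ⟩
        weight (suc k) 0 χ + 8           ∎
        where open ≤-Reasoning
      ... | two i j pi pj eq le = subst (λ s → 3 * (n + s) ≤ weight (suc k) 0 χ + 8) (+-identityʳ (suc k))
        (two-copies k 0 χ i j (≤-trans (≤-trans (s≤s z≤n) 3≤k) (m≤m+n k 0)) pi pj (≤-trans p (≤-reflexive (sym eq))) le)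
      ... | many i j l pi pj pl le = ≤-trans (mixed-copies k χ i j l (cut-bound₁ k) noFull pi pj pl le) (+-monoʳ-≤ _ (m≤n+m 6 2))

    -- The triangle and its boundary.

    n≤t : ∀ k → n ≤ t k n
    n≤t k = ≤-trans (m≤m+n n k) (n+k≤t 3≤n k)

    corner-vertex : ∀ k → Fin 3 → Vertex k n
    corner-vertex zero    a = Fin.inject≤ a 3≤n
    corner-vertex (suc k) a = Fin.zero , corner-vertex k a

    uid-corner-vertex : ∀ k a → uid k n (corner-vertex k a) ≡ toℕ a
    uid-corner-vertex zero    a = Fin.toℕ-inject≤ a 3≤n
    uid-corner-vertex (suc k) a = uid-corner-vertex k a

    corner-vertex-injective : ∀ k {a b} → corner-vertex k a ≡ corner-vertex k b → a ≡ b
    corner-vertex-injective k {a} {b} eq = toℕ-injective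
      (trans (sym (uid-corner-vertex k a)) (trans (cong (uid k n) eq) (uid-corner-vertex k b)))

    corner-corner-vertex : ∀ k a → corner k (corner-vertex k a) ≡ true
    corner-corner-vertex k a = dec-true (_ <? 3) (subst (_< 3) (sym (uid-corner-vertex k a)) (toℕ<n a))

    corner⇒corner-vertex : ∀ k v → corner k v ≡ true → ∃ λ a → corner-vertex k a ≡ v
    corner⇒corner-vertex k v eq = fromℕ< lt ,
      uid-injective k (trans (uid-corner-vertex k (fromℕ< lt)) (toℕ-fromℕ< lt))
      where
      lt : uid k n v < 3
      lt = does-true (uid k n v <? 3) eq

    -- Outside copy 0 the `uid` is at least `t k n`, hence at least 3.
    corner-away : ∀ k i v → i ≢ Fin.zero → corner (suc k) (i , v) ≡ false
    corner-away k Fin.zero    v i≢0 = contradiction refl i≢0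
    corner-away k (Fin.suc i) v _   = dec-false (_ <? 3) (≤⇒≯ (≤-trans (≤-trans 3≤n (n≤t k))
      (≤-trans (m≤m+n (t k n) _) (m≤m+n _ (uid k n v)))))

    corner-vertices : ∀ k → List (Vertex k n)
    corner-vertices k = map (corner-vertex k) (allFin 3)

    corner-vertices-unique : ∀ k → Unique (corner-vertices k)
    corner-vertices-unique k = Unique.map⁺ (corner-vertex-injective k) (Unique.allFin⁺ 3)

    size-corner≤3 : ∀ k → size k (corner k) ≤ 3
    size-corner≤3 k = begin
      size k (corner k)                      ≡⟨ length-filter (λ v → uid k n v <? 3) (vertices k) ⟨
      length corners                         ≡⟨ length-map (uid k n) corners ⟨
      length (map (uid k n) corners)         ≤⟨ length-⊆ (Unique.map⁺ (uid-injective k) (Unique.filter⁺ _ (vertices-unique k))) below ⟩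
      length (upTo 3)                        ≡⟨⟩
      3                                      ∎
      where
      open ≤-Reasoning
      corners : List (Vertex k n)
      corners = filter (λ v → uid k n v <? 3) (vertices k)
      below : map (uid k n) corners ⊆ upTo 3
      below p with ∈-map⁻ (uid k n) p
      ... | v , q , refl = ∈-upTo⁺ (proj₂ (∈-filter⁻ (λ v → uid k n v <? 3) {xs = vertices k} q))

    3≤size-corner : ∀ k → 3 ≤ size k (corner k)
    3≤size-corner k = length≤size k (corner k) (corner-vertices-unique k)
      (All.map⁺ (All.tabulate (λ {a} _ → corner-corner-vertex k a)))

    -- At level 0 the triangle has `3 * (n - 3)` boundary edges, and each further level adds at most
    -- one cross edge per vertex of the triangle. In terms of the degree this is `3d - 6`.
    cut-corner : ∀ k → cut k (corner k) + 9 ≤ 3 * (n + k)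
    cut-corner zero = ≤-reflexive (begin
      cut 0 (corner 0) + 9       ≡⟨ cong (_+ 9) (cut-zero (corner 0)) ⟩
      size 0 (corner 0) * q + 9  ≡⟨ cong (λ m → m * q + 9) size≡3 ⟩
      3 * q + 9                  ≡⟨ expand q ⟩
      3 * (3 + q + 0)            ≡⟨ cong (λ m → 3 * (m + q + 0)) size≡3 ⟨
      3 * (size 0 (corner 0) + q + 0) ≡⟨ cong (λ m → 3 * (m + 0)) (size-co 0 (corner 0)) ⟩
      3 * (n + 0)                ∎)
      where
      open ≡-Reasoning
      q : ℕ
      q = size 0 (co (corner 0))
      size≡3 : size 0 (corner 0) ≡ 3
      size≡3 = ≤-antisym (size-corner≤3 0) (3≤size-corner 0)
      expand : ∀ q → 3 * q + 9 ≡ 3 * (3 + q + 0)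
      expand = solve-∀
    cut-corner (suc k) = begin
      cut (suc k) (corner (suc k)) + 9      ≡⟨ cong (_+ 9) (cut-cross k (corner (suc k))) ⟩
      ∑ (copies k) (λ i → cut k (copy (corner (suc k)) i)) + ∑ (vertices (suc k)) f + 9
        ≤⟨ +-monoˡ-≤ 9 (+-mono-≤ inside (≤-trans (∑-mono (vertices (suc k)) crosses≤) (size-corner≤3 (suc k)))) ⟩
      cut k (corner k) + 3 + 9              ≡⟨ rearrange (cut k (corner k)) ⟩
      cut k (corner k) + 9 + 3              ≤⟨ +-monoˡ-≤ 3 (cut-corner k) ⟩
      3 * (n + k) + 3                       ≡⟨ expand n k ⟩
      3 * (n + suc k)                       ∎
      where
      open ≤-Reasoning
      f : Vertex (suc k) n → ℕ
      f x = ⟦ crosses (corner (suc k)) (x , partner k x) ⟧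
      inside : ∑ (copies k) (λ i → cut k (copy (corner (suc k)) i)) ≤ cut k (corner k)
      inside = ∑-single _ Fin.zero (λ i i≢0 → cut-false k _ (λ v → corner-away k i v i≢0))
      crosses≤ : ∀ x → f x ≤ ⟦ corner (suc k) x ⟧
      crosses≤ x with corner (suc k) x | corner (suc k) (partner k x)
      ... | false | _     = z≤n
      ... | true  | false = ≤-refl
      ... | true  | true  = z≤n
      rearrange : ∀ x → x + 3 + 9 ≡ x + 9 + 3
      rearrange = solve-∀
      expand : ∀ n k → 3 * (n + k) + 3 ≡ 3 * (n + suc k)
      expand = solve-∀

    corner-clique : ∀ k {a b} → a ≢ b → Adj k n (corner-vertex k a) (corner-vertex k b)
    corner-clique zero    a≢b eq = a≢b (corner-vertex-injective zero eq)
    corner-clique (suc k) a≢b    = inj₁ (refl , corner-clique k a≢b)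

    -- The neighbours come from the `K_n` of `u`, which has at least three vertices. The predicate
    -- `P` is carried along so that the lemma can be applied inside a copy lying wholly off the
    -- triangle.
    two-neighbours : ∀ k {P : Vertex k n → Set} → (∀ v → P v) → ∀ u → TwoNeighbours k P u
    two-neighbours zero    P u = go 3≤n P u
      where
      go : ∀ {m} {P : Fin m → Set} → 3 ≤ m → (∀ v → P v) → ∀ u → ∃ λ a → ∃ λ b → a ≢ b × (u ≢ a × P a) × (u ≢ b × P b)
      go (s≤s (s≤s (s≤s _))) P u = punchIn u Fin.zero , punchIn u (Fin.suc Fin.zero) ,
        (λ eq → case punchIn-injective u _ _ eq of λ ()) ,
        (punchInᵢ≢i u Fin.zero ∘ sym , P _) , (punchInᵢ≢i u (Fin.suc Fin.zero) ∘ sym , P _)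
    two-neighbours (suc k) P (i , u) with two-neighbours k (λ v → P (i , v)) u
    ... | a , b , a≢b , (ua , Pa) , (ub , Pb) =
      (i , a) , (i , b) , a≢b ∘ cong proj₂ , (inj₁ (refl , ua) , Pa) , (inj₁ (refl , ub) , Pb)

    corner-partner : ∀ k u → corner (suc k) (partner k (Fin.zero , u)) ≡ false
    corner-partner k u = corner-away k (target k (Fin.zero , u)) (proj₂ (partner k (Fin.zero , u)))
      (punchInᵢ≢i Fin.zero (index k u))

    neighbour-off-corner : ∀ k u → ∃ λ v → Adj (suc k) n u v × corner (suc k) v ≡ false
    neighbour-off-corner k (i , u) with i Fin.≟ Fin.zero
    ... | no i≢0 with two-neighbours k (λ v → corner-away k i v i≢0) u
    ... | a , _ , _ , (ua , off) , _ = (i , a) , inj₁ (refl , ua) , off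
    neighbour-off-corner k (i , u) | yes refl = partner k (i , u) , linked⇒Adj k (linked-partner k (i , u)) ,
      corner-partner k u

    -- Outside copy 0 the `K_n` of `u` suffices. In copy 0 one neighbour is reached by the outermost
    -- cross edge and the other inside the copy by `neighbour-off-corner`, which may use a cross
    -- edge of the next level; hence the level `2 + k`.
    two-neighbours-off-corner : ∀ k u → TwoNeighbours (2 + k) (λ v → corner (2 + k) v ≡ false) u
    two-neighbours-off-corner k (i , u) with i Fin.≟ Fin.zero
    ... | no i≢0 with two-neighbours (suc k) (λ v → corner-away (suc k) i v i≢0) u
    ... | a , b , a≢b , (ua , off-a) , (ub , off-b) =
      (i , a) , (i , b) , a≢b ∘ cong proj₂ , (inj₁ (refl , ua) , off-a) , (inj₁ (refl , ub) , off-b)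
    two-neighbours-off-corner k (i , u) | yes refl with neighbour-off-corner k u
    ... | v , uv , off = partner (suc k) (i , u) , (i , v) , punchInᵢ≢i i (index (suc k) u) ∘ cong proj₁ ,
      (linked⇒Adj (suc k) (linked-partner (suc k) (i , u)) , corner-partner (suc k) u) ,
      (inj₁ (refl , uv) , off)

    corner-restrictedCut : ∀ k → RestrictedCut (2 + k) n 3 (boundary (2 + k) (corner (2 + k)))
    corner-restrictedCut k = boundary-isEdgeSet K (corner K) , disconnected , components
      where
      K : ℕ
      K = 2 + k
      F : List (Vertex K n × Vertex K n)
      F = boundary K (corner K)
      disconnected : Disconnected K n F
      disconnected = u , proj₁ away , λ r → case trans (sym (corner-corner-vertex K Fin.zero))
        (trans (boundary-separates K (corner K) r) (proj₂ (proj₂ away))) of λ ()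
        where
        u : Vertex K n
        u = corner-vertex K Fin.zero
        away : ∃ λ v → Adj K n u v × corner K v ≡ false
        away = neighbour-off-corner (suc k) u
      components : ∀ u → CompAtLeast K n 3 F u
      components u with corner K u in eq
      -- Off the triangle, `u` and two of its neighbours off the triangle form the required three
      -- vertices; on it, the triangle itself serves.
      ... | false = case two-neighbours-off-corner k u of λ where
        (a , b , a≢b , (ua , off-a) , (ub , off-b)) → u ∷ a ∷ b ∷ [] , refl ,
          ((λ { refl → Adj-irrefl K ua }) ∷ (λ { refl → Adj-irrefl K ub }) ∷ []) ∷ (a≢b ∷ []) ∷ [] ∷ [] ,
          here ∷ step here (boundary-keeps K (corner K) ua (trans eq (sym off-a))) ∷
          step here (boundary-keeps K (corner K) ub (trans eq (sym off-b))) ∷ []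
      ... | true with corner⇒corner-vertex K u eq
      ... | a , refl = corner-vertices K , refl , corner-vertices-unique K , All.map⁺ (All.tabulate (λ {b} _ → reach b))
        where
        reach : ∀ b → Reach K n F (corner-vertex K a) (corner-vertex K b)
        reach b with a Fin.≟ b
        ... | yes refl = here
        ... | no a≢b   = step here (boundary-keeps K (corner K) (corner-clique K a≢b)
          (trans eq (sym (corner-corner-vertex K b))))

    -- Comparison of the two bounds.

    open Component

    -- The set is the component of `u`. Its complement contains the component of `v`, so both sides
    -- have four vertices, and every edge leaving the set was removed.
    cut-large : ∀ k F → 4 ≤ k → ∀ {u v} → ¬ Reach k n F u v → (C : Component k F u) (D : Component k F v) →
      4 ≤ length (members C) → 4 ≤ length (members D) → 3 * (n + k) ≤ length F + 8
    cut-large k F 4≤k {u} {v} ¬uv C D 4≤C 4≤D = ≤-trans (cut-bound₄ k 4≤k χ 4≤χ 4≤coχ) (+-monoˡ-≤ 8 (cut≤length k F χ removed))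
      where
      open DecMembership (_≟ᵛ_ {k}) using (_∈?_)
      χ : Vertex k n → Bool
      χ w = does (w ∈? members C)
      4≤χ : 4 ≤ size k χ
      4≤χ = ≤-trans 4≤C (length≤size k χ (unique C) (All.tabulate (λ {w} p → dec-true (w ∈? members C) p)))
      4≤coχ : 4 ≤ size k (co χ)
      4≤coχ = ≤-trans 4≤D (length≤size k (co χ) (unique D) (All.map (λ {w} r → cong not (dec-false (w ∈? members C)
        (λ p → ¬uv (Reach-trans k F (All.lookup (reached C) p) (Reach-sym k F r))))) (reached D)))
      removed : ∀ {a b} → Adj k n a b → χ a ≡ true → χ b ≡ false → Removed k n F a b
      removed {a} {b} adj χa χb with a ∈? members C | b ∈? members C | removed? k F a b
      ... | _      | _      | yes r = r
      ... | yes a∈ | no b∉  | no ¬r = contradiction (complete C b (step (All.lookup (reached C) a∈) (adj , ¬r))) b∉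

    superLambda₃ : ∀ k → 4 ≤ k → SuperLambda k n 3
    -- Matching on the bound exposes `k` as `2 + k′`, the form in which `corner-restrictedCut` is
    -- available.
    superLambda₃ k 4≤k@(s≤s (s≤s {n = k′} _)) F ((_ , (u , v , ¬uv) , atLeast) , minimal)
      with component k F u | component k F v
    ... | C | D with exactly-or-more k F C (atLeast u) | exactly-or-more k F D (atLeast v)
    ... | inj₁ exact | _          = u , exact
    ... | inj₂ _     | inj₁ exact = v , exact
    ... | inj₂ 4≤C   | inj₂ 4≤D   = contradiction too-large (<⇒≱ (n<1+n _))
      where
      open ≤-Reasoning
      too-large : suc (length F + 8) ≤ length F + 8
      -- Minimality against the triangle gives at most `3 * (n + k) - 9` edges, while two components
      -- of at least four vertices force at least `3 * (n + k) - 8`.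
      too-large = begin
        suc (length F + 8)                  ≡⟨ +-suc (length F) 8 ⟨
        length F + 9                        ≤⟨ +-monoˡ-≤ 9 (minimal _ (corner-restrictedCut k′)) ⟩
        length (boundary k (corner k)) + 9  ≡⟨ cong (_+ 9) (length-boundary k (corner k)) ⟩
        cut k (corner k) + 9                ≤⟨ cut-corner k ⟩
        3 * (n + k)                         ≤⟨ cut-large k F 4≤k ¬uv C D 4≤C 4≤D ⟩
        length F + 8                        ∎

theorem11 : ∀ k n → 4 ≤ k → 3 ≤ n → SuperLambda k n 3
theorem11 k n 4≤k 3≤n = superLambda₃ 3≤n k 4≤k
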